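{- Let $p \geq 5$ be a prime and let $a, b$ be nonnegative integers. Then \[ \binom{ap}{bp}_q \equiv \binom{a}{b}_{q^{p^2}} - \binom{a}{b+1}\binom{b+1}{2}\frac{p^2-1}{12}(q^p-1)^2 \pmod{[p]_q^3}, \] where the congruence is understood in the ring $\mathbb{Z}[q]$ of polynomials in $q$ with integer coefficients (i.e. the difference of the two sides is $[p]_q^3$ times a polynomial in $\mathbb{Z}[q]$).
   Context: For a nonnegative integer $n$, $[n]_q := 1 + q + \cdots + q^{n-1}$ (so $[0]_q=0$), $[n]_q! := [n]_q [n-1]_q \cdots [1]_q$ (with $[0]_q! = 1$), and for integers $0 \le k \le n$ the $q$-binomial coefficient is $\binom{n}{k}_q := \frac{[n]_q!}{[k]_q!\,[n-k]_q!}$, which is a polynomial in $q$ with nonnegative integer coefficients; $\binom{n}{k}_q := 0$ if $k > n$. The notation $\binom{a}{b}_{q^{p^2}}$ means the $q$-binomial coefficient with $q$ replaced by $q^{p^2}$. The symbols $\binom{a}{b+1}$ and $\binom{b+1}{2}$ are ordinary binomial coefficients. Note $12$ divides $p^2-1$ for primes $p \ge 5$. -}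

module Defs where

open import Data.Nat as ℕ using (ℕ; zero; suc)
open import Data.Integer as ℤ using (ℤ; +_)
open import Data.List using (List; []; _∷_)
open import Relation.Binary.PropositionalEquality using (_≡_)
open import Data.Product using (Σ; _×_)
open import Data.Sum using (_⊎_)

-- Polynomials in ℤ[q], represented by coefficient lists (constant term first).
-- Trailing zeros are allowed; equality is coefficientwise (_≈ₚ_).
Poly : Set
Poly = List ℤ

coeff : Poly → ℕ → ℤ
coeff []       _       = + 0
coeff (a ∷ f)  zero    = a
coeff (a ∷ f)  (suc n) = coeff f n

infix 4 _≈ₚ_
_≈ₚ_ : Poly → Poly → Set
f ≈ₚ g = (n : ℕ) → coeff f n ≡ coeff g n

const : ℤ → Poly
const a = a ∷ []

0ₚ 1ₚ qₚ : Poly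
0ₚ = []
1ₚ = const (+ 1)
qₚ = + 0 ∷ + 1 ∷ []

infixl 6 _+ₚ_ _-ₚ_
infixl 7 _*ₚ_

_+ₚ_ : Poly → Poly → Poly
[]      +ₚ g       = g
(a ∷ f) +ₚ []      = a ∷ f
(a ∷ f) +ₚ (b ∷ g) = (a ℤ.+ b) ∷ (f +ₚ g)

scale : ℤ → Poly → Poly
scale c []      = []
scale c (a ∷ f) = (c ℤ.* a) ∷ scale c f

negₚ : Poly → Poly
negₚ = scale (ℤ.- (+ 1))

_-ₚ_ : Poly → Poly → Poly
f -ₚ g = f +ₚ negₚ g

_*ₚ_ : Poly → Poly → Poly
[]      *ₚ g = []
(a ∷ f) *ₚ g = scale a g +ₚ (+ 0 ∷ (f *ₚ g))

infixr 8 _^ₚ_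
_^ₚ_ : Poly → ℕ → Poly
f ^ₚ zero  = 1ₚ
f ^ₚ suc n = f *ₚ (f ^ₚ n)

qnum : Poly → ℕ → Poly
qnum x zero    = 0ₚ
qnum x (suc n) = 1ₚ +ₚ x *ₚ qnum x n

qfact : Poly → ℕ → Poly
qfact x zero    = 1ₚ
qfact x (suc n) = qnum x (suc n) *ₚ qfact x n

-- B is the q-binomial coefficient (n choose k)_x, following the definition
-- [n]_x! / ([k]_x! [n-k]_x!) (a polynomial; ℤ[q] is a domain so B is unique),
-- and 0 when k > n.
IsQBinom : Poly → ℕ → ℕ → Poly → Set
IsQBinom x n k B =
  (k ℕ.≤ n × (qfact x k *ₚ qfact x (n ℕ.∸ k) *ₚ B ≈ₚ qfact x n))
  ⊎ (n ℕ.< k × B ≈ₚ 0ₚ)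

_≡_[modₚ_] : Poly → Poly → Poly → Set
f ≡ g [modₚ m ] = Σ Poly (λ h → f -ₚ g ≈ₚ m *ₚ h)

{-# OPTIONS --safe #-}
-- Write Φ = [p]_q, B = binom(-,-)_q. By q-Vandermonde, binom((a+1)p,(b+1)p)_q consists of the two
-- terms of the Pascal rule for base q^(p²) and of Σ_{0<i<p} B(p,i) q^(i(bp+i)) B(ap,bp+i).
-- Both binomials of the last sum are divisible by Φ, and B(ap,bp+i) ≡ (b+1)C(a,b+1) B(p,i) mod Φ²
-- (absorption and q-Lucas), so modulo Φ³ the sum is (b+1)C(a,b+1) S with S = Σ_{0<i<p} B(p,i)² q^(i²).
-- These multiplicities add up to C(a,b+1) C(b+1,2) by Pascal's rule.
-- Since (1-q^i) B(p,i) = (1-q^p) B(p-1,i-1) and q^(k(k+1)) B(p-1,k)² ≡ 1 mod Φ, evaluating S amounts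
-- to Σ_{0<i<p} ζ^i/(1-ζ^i)² = -(p²-1)/12 for ζ a primitive p-th root of unity. This follows from
-- 2p x/(1-x)² = Σ_{j<p} j(p-j)x^j for x = ζ^i after summing over i. The division by 12p is harmless
-- because Φ³ has constant term 1, so ℤ[q]/Φ³ is torsion-free.
module Submission where

open import Defs
open import Data.Nat using (ℕ; _≤_; _+_; _*_; _^_; _∸_; _/_)
open import Data.Nat.Combinatorics using (_C_)
open import Data.Nat.Primality using (Prime)
open import Data.Integer using (+_)

open import Algebra.Bundles using (CommutativeRing; RawRing)
import Algebra.Properties.Semiring.Exp as Exp
import Algebra.Solver.Ring
open import Algebra.Solver.Ring.AlmostCommutativeRing using (AlmostCommutativeRing; fromCommutativeRing; _-Raw-AlmostCommutative⟶_)
open import Data.Integer as ℤ using (ℤ)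
open import Data.Integer.Divisibility.Signed as ℤ∣ using () renaming (_∣_ to _∣ℤ_; divides to dividesℤ)
import Data.Integer.Properties as ℤₚ
import Data.Integer.Tactic.RingSolver as ℤ-Solver
open import Data.List using ([]; _∷_)
open import Data.Maybe using (Maybe; just; nothing)
open import Data.Nat using (zero; suc; _<_; _%_; z≤n; s≤s)
open import Data.Nat.Combinatorics using (nC1≡n; nCk+nC[k+1]≡[n+1]C[k+1])
open import Data.Nat.Coprimality as Coprimality using (Coprime)
open import Data.Nat.Divisibility using (_∣_; divides)
open import Data.Nat.DivMod using (m≡m%n+[m/n]*n; m%n<n; m*n/n≡m)
open import Data.Nat.GCD using (module Bézout)
open import Data.Nat.Primality using (prime⇒irreducible)
import Data.Nat.Properties as ℕₚ
open import Data.Nat.Tactic.RingSolver using (solve-∀)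
open import Data.Product using (Σ; _,_; proj₁; proj₂)
open import Data.Sum using (inj₁; inj₂)
open import Function using (_∘_)
open import Level using (0ℓ)
open import Relation.Binary using (Setoid)
open import Relation.Binary.PropositionalEquality as ≡ using (_≡_; _≢_; refl; sym; trans; cong; cong₂; subst)
import Relation.Binary.Reasoning.Setoid as SetoidReasoning
open import Relation.Nullary using (¬_; contradiction; yes; no)

-- The computation with `ζ^i` takes place in `ℤ[q]` modulo Φ, with `q^i` in place of `ζ^i`. Inverses
-- there come from two sources: `q^p ≡ 1` makes `q` a unit, and Bézout's `x k = 1 + y p` gives
-- `[xk] = 1 + q [yp]`, so that `[k]` is a unit whenever `k` is coprime to `p`. The factor `1 - ζ^i`
-- has norm `p` and is no unit, so the fraction `ζ^i/(1-ζ^i)²` is never formed: its denominator is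
-- cleared against `B(p,i)²`. The third power of Φ is reached by multiplication. Since `B(p,i)²` and
-- `(q^p-1)²` are multiples of Φ², every identity for roots of unity is needed modulo Φ only. For
-- the same reason `S` is a multiple of Φ², and the powers of `q^(p²)` that Pascal's rule puts in
-- front of it may be replaced by 1. The 12 is 2 times 6: the 2 stems from `2p x/(1-x)²`, the 6 from
-- `Σ_(j<p) j(p-j) = p(p²-1)/6`.

ℤ-rawRing : RawRing 0ℓ 0ℓ
ℤ-rawRing = AlmostCommutativeRing.rawRing (fromCommutativeRing ℤₚ.+-*-commutativeRing)

-- Ordinary binomial coefficients

C-absorption : ∀ a b → suc a * (a C b) ≡ suc b * (suc a C suc b)
C-absorption a       zero    = trans (ℕₚ.*-identityʳ (suc a)) (trans (sym (nC1≡n (suc a))) (sym (ℕₚ.*-identityˡ _)))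
C-absorption zero    (suc b) = sym (ℕₚ.*-zeroʳ (suc (suc b)))
C-absorption (suc a) (suc b) = begin
  suc (suc a) * (suc a C suc b)
    ≡⟨ cong (suc (suc a) *_) (sym (nCk+nC[k+1]≡[n+1]C[k+1] a b)) ⟩
  suc (suc a) * (a C b + a C suc b)
    ≡⟨ expand (suc a) (a C b) (a C suc b) ⟩
  (a C b + a C suc b) + (suc a * (a C b) + suc a * (a C suc b))
    ≡⟨ cong₂ _+_ (nCk+nC[k+1]≡[n+1]C[k+1] a b) (cong₂ _+_ (C-absorption a b) (C-absorption a (suc b))) ⟩
  (suc a C suc b) + (suc b * (suc a C suc b) + suc (suc b) * (suc a C suc (suc b)))
    ≡⟨ collect (suc b) (suc a C suc b) (suc a C suc (suc b)) ⟩
  suc (suc b) * ((suc a C suc b) + (suc a C suc (suc b)))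
    ≡⟨ cong (suc (suc b) *_) (nCk+nC[k+1]≡[n+1]C[k+1] (suc a) (suc b)) ⟩
  suc (suc b) * (suc (suc a) C suc (suc b)) ∎
  where
  open ≡.≡-Reasoning
  expand : ∀ a x y → suc a * (x + y) ≡ (x + y) + (a * x + a * y)
  expand = solve-∀
  collect : ∀ b x y → x + (b * x + suc b * y) ≡ suc b * (x + y)
  collect = solve-∀

-- The number of copies of `S` collected when the Vandermonde step is iterated: the solution of the
-- recurrence `multiplicity-step` with zero boundary values.
multiplicity : ℕ → ℕ → ℕ
multiplicity a b = (a C suc b) * (suc b C 2)

-- Pascal's rule acts on both factors; `C(b+2,2) = (b+1) + C(b+1,2)` splits off the inhomogeneous
-- term.
multiplicity-step : ∀ a b → multiplicity (suc a) (suc b) ≡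
                    multiplicity a b + multiplicity a (suc b) + suc b * (a C suc b)
multiplicity-step a b = begin
  (suc a C suc (suc b)) * c₂
    ≡⟨ cong (_* c₂) (sym (nCk+nC[k+1]≡[n+1]C[k+1] a (suc b))) ⟩
  (a C suc b + a C suc (suc b)) * c₂
    ≡⟨ ℕₚ.*-distribʳ-+ c₂ (a C suc b) (a C suc (suc b)) ⟩
  (a C suc b) * c₂ + multiplicity a (suc b)
    ≡⟨ cong (λ c → (a C suc b) * c + multiplicity a (suc b)) (trans (sym (nCk+nC[k+1]≡[n+1]C[k+1] (suc b) 1)) (cong (_+ (suc b C 2)) (nC1≡n (suc b)))) ⟩
  (a C suc b) * (suc b + suc b C 2) + multiplicity a (suc b)
    ≡⟨ rearrange (a C suc b) (suc b) (suc b C 2) (multiplicity a (suc b)) ⟩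
  multiplicity a b + multiplicity a (suc b) + suc b * (a C suc b) ∎
  where
  open ≡.≡-Reasoning
  c₂ = suc (suc b) C 2
  rearrange : ∀ x b c y → x * (b + c) + y ≡ x * c + y + b * x
  rearrange = solve-∀

-- q-binomial coefficients over a commutative ring
module QAnalogues
  (R : CommutativeRing 0ℓ 0ℓ)
  (ι : ℤ-rawRing -Raw-AlmostCommutative⟶ fromCommutativeRing R)
  where

  open CommutativeRing R public
    using (Carrier; _≈_; 0#; 1#; setoid; +-cong; *-cong; *-identityˡ; *-identityʳ; +-identityˡ; +-identityʳ; *-comm; +-comm; *-assoc; +-assoc; -‿cong; zeroˡ; zeroʳ; -‿inverseʳ)
    renaming (_+_ to _⊕_; _*_ to _⊗_; _-_ to _⊖_; refl to ≈-refl; sym to ≈-sym; trans to ≈-trans; reflexive to ≈-reflexive; +-congˡ to R-+-congˡ; *-congˡ to R-*-congˡ; +-congʳ to R-+-congʳ; *-congʳ to R-*-congʳ)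
  open Exp (CommutativeRing.semiring R) public
    using (^-congˡ; ^-homo-*; ^-assocʳ) renaming (_^_ to _↑_)
  open _-Raw-AlmostCommutative⟶_ ι using () renaming (⟦_⟧ to ⟦_⟧ℤ; +-homo to ι-+; *-homo to ι-*; -‿homo to ι-neg; 0-homo to ι-0; 1-homo to ι-1)
  open SetoidReasoning setoid

  -- The solver interprets numerals definitionally, so 0 and 1 must denote 0# and 1# on the nose.
  eval : ℤ → Carrier
  eval (+ 0) = 0#
  eval (+ 1) = 1#
  eval n     = ⟦ n ⟧ℤ

  eval-ι : ∀ n → eval n ≈ ⟦ n ⟧ℤ
  eval-ι (+ 0)             = ≈-sym ι-0
  eval-ι (+ 1)             = ≈-sym ι-1
  eval-ι (+ suc (suc n))   = ≈-refl
  eval-ι (ℤ.-[1+ n ])      = ≈-refl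

  eval-hom : ℤ-rawRing -Raw-AlmostCommutative⟶ fromCommutativeRing R
  eval-hom = record
    { ⟦_⟧    = eval
    ; +-homo = λ m n → ≈-trans (eval-ι (m ℤ.+ n)) (≈-trans (ι-+ m n) (≈-sym (+-cong (eval-ι m) (eval-ι n))))
    ; *-homo = λ m n → ≈-trans (eval-ι (m ℤ.* n)) (≈-trans (ι-* m n) (≈-sym (*-cong (eval-ι m) (eval-ι n))))
    ; -‿homo = λ n → ≈-trans (eval-ι (ℤ.- n)) (≈-trans (ι-neg n) (≈-sym (-‿cong (eval-ι n))))
    ; 0-homo = ≈-refl
    ; 1-homo = ≈-refl }

  eval≟ : ∀ m n → Maybe (eval m ≈ eval n)
  eval≟ m n with m ℤ.≟ n
  ... | yes m≡n = just (≈-reflexive (cong eval m≡n))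
  ... | no  _   = nothing

  module Solver = Algebra.Solver.Ring _ (fromCommutativeRing R) eval-hom eval≟
  open Solver public using (solve; _:+_; _:*_; _:-_; :-_; con; _:=_; Polynomial)

  :0 :1 :2 : ∀ {n} → Polynomial n
  :0 = con (+ 0)
  :1 = con (+ 1)
  :2 = con (+ 2)

  infix 9 #_
  #_ : ℕ → Carrier
  # n = eval (+ n)

  #-+ : ∀ m n → # (m + n) ≈ # m ⊕ # n
  #-+ m n = _-Raw-AlmostCommutative⟶_.+-homo eval-hom (+ m) (+ n)

  #-* : ∀ m n → # (m * n) ≈ # m ⊗ # n
  #-* m n = ≈-trans (≈-reflexive (cong eval (ℤₚ.pos-* m n))) (_-Raw-AlmostCommutative⟶_.*-homo eval-hom (+ m) (+ n))

  +-congˡ : ∀ f {g h} → g ≈ h → f ⊕ g ≈ f ⊕ h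
  +-congˡ f = R-+-congˡ

  +-congʳ : ∀ {f g} h → f ≈ g → f ⊕ h ≈ g ⊕ h
  +-congʳ h = R-+-congʳ

  *-congˡ : ∀ f {g h} → g ≈ h → f ⊗ g ≈ f ⊗ h
  *-congˡ f = R-*-congˡ

  *-congʳ : ∀ {f g} h → f ≈ g → f ⊗ h ≈ g ⊗ h
  *-congʳ h = R-*-congʳ

  ⊖-cong : ∀ {f g h k} → f ≈ g → h ≈ k → f ⊖ h ≈ g ⊖ k
  ⊖-cong p r = +-cong p (-‿cong r)

  difference-zero : ∀ {f g} → f ⊖ g ≈ 0# → f ≈ g
  difference-zero {f} {g} e = begin
    f               ≈⟨ solve 2 (λ f g → f := (f :- g) :+ g) ≈-refl f g ⟩
    (f ⊖ g) ⊕ g     ≈⟨ +-congʳ g e ⟩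
    0# ⊕ g          ≈⟨ +-identityˡ g ⟩
    g               ∎

  zero-cancel⇒cancel : ∀ m → (∀ f → m ⊗ f ≈ 0# → f ≈ 0#) → ∀ {f g} → m ⊗ f ≈ m ⊗ g → f ≈ g
  zero-cancel⇒cancel m cancel {f} {g} e = difference-zero (cancel (f ⊖ g) (begin
    m ⊗ (f ⊖ g)            ≈⟨ solve 3 (λ f g m → m :* (f :- g) := m :* f :- m :* g) ≈-refl f g m ⟩
    m ⊗ f ⊖ m ⊗ g          ≈⟨ +-congʳ _ e ⟩
    m ⊗ g ⊖ m ⊗ g          ≈⟨ -‿inverseʳ (m ⊗ g) ⟩
    0#                     ∎))

  -- Finite sums and q-integers

  ∑ : ℕ → (ℕ → Carrier) → Carrier
  ∑ zero    f = 0#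
  ∑ (suc n) f = ∑ n f ⊕ f n

  ∑-cong : ∀ n {f g} → (∀ i → i < n → f i ≈ g i) → ∑ n f ≈ ∑ n g
  ∑-cong zero    e = ≈-refl
  ∑-cong (suc n) e = +-cong (∑-cong n (λ i i<n → e i (ℕₚ.m<n⇒m<1+n i<n))) (e n (ℕₚ.n<1+n n))

  ∑-head : ∀ n f → ∑ (suc n) f ≈ f 0 ⊕ ∑ n (λ i → f (suc i))
  ∑-head zero    f = +-comm 0# (f 0)
  ∑-head (suc n) f = ≈-trans (+-congʳ _ (∑-head n f)) (+-assoc _ _ _)

  ∑-+ : ∀ n f g → ∑ n (λ i → f i ⊕ g i) ≈ ∑ n f ⊕ ∑ n g
  ∑-+ zero    f g = ≈-sym (+-identityˡ 0#)
  ∑-+ (suc n) f g = ≈-trans (+-congʳ _ (∑-+ n f g))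
    (solve 4 (λ s t a b → s :+ t :+ (a :+ b) := s :+ a :+ (t :+ b)) ≈-refl _ _ _ _)

  ∑-*ˡ : ∀ n c f → ∑ n (λ i → c ⊗ f i) ≈ c ⊗ ∑ n f
  ∑-*ˡ zero    c f = ≈-sym (zeroʳ c)
  ∑-*ˡ (suc n) c f = ≈-trans (+-congʳ _ (∑-*ˡ n c f))
    (solve 3 (λ c s a → c :* s :+ c :* a := c :* (s :+ a)) ≈-refl _ _ _)

  ∑-0 : ∀ n → ∑ n (λ _ → 0#) ≈ 0#
  ∑-0 zero    = ≈-refl
  ∑-0 (suc n) = ≈-trans (+-identityʳ _) (∑-0 n)

  ∑-swap : ∀ m n (f : ℕ → ℕ → Carrier) → ∑ m (λ i → ∑ n (f i)) ≈ ∑ n (λ j → ∑ m (λ i → f i j))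
  ∑-swap zero    n f = ≈-sym (∑-0 n)
  ∑-swap (suc m) n f = ≈-trans (+-congʳ _ (∑-swap m n f)) (≈-sym (∑-+ n _ (f m)))

  qint : Carrier → ℕ → Carrier
  qint x zero    = 0#
  qint x (suc n) = 1# ⊕ x ⊗ qint x n

  qfactorial : Carrier → ℕ → Carrier
  qfactorial x zero    = 1#
  qfactorial x (suc n) = qint x (suc n) ⊗ qfactorial x n

  qint-+ : ∀ x m n → qint x (m + n) ≈ qint x m ⊕ x ↑ m ⊗ qint x n
  qint-+ x zero    n = solve 1 (λ s → s := :0 :+ :1 :* s) ≈-refl (qint x n)
  qint-+ x (suc m) n = begin
    1# ⊕ x ⊗ qint x (m + n)                            ≈⟨ +-congˡ 1# (*-congˡ x (qint-+ x m n)) ⟩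
    1# ⊕ x ⊗ (qint x m ⊕ x ↑ m ⊗ qint x n)          ≈⟨ solve 4 (λ x s y t → :1 :+ x :* (s :+ y :* t) := (:1 :+ x :* s) :+ (x :* y) :* t) ≈-refl x _ _ _ ⟩
    (1# ⊕ x ⊗ qint x m) ⊕ x ↑ suc m ⊗ qint x n      ∎

  qint-* : ∀ x m n → qint x (m * n) ≈ qint (x ↑ n) m ⊗ qint x n
  qint-* x zero    n = ≈-sym (zeroˡ _)
  qint-* x (suc m) n = begin
    qint x (n + m * n)                                       ≈⟨ qint-+ x n (m * n) ⟩
    qint x n ⊕ x ↑ n ⊗ qint x (m * n)                     ≈⟨ +-congˡ _ (*-congˡ _ (qint-* x m n)) ⟩
    qint x n ⊕ x ↑ n ⊗ (qint (x ↑ n) m ⊗ qint x n)      ≈⟨ solve 3 (λ s y t → s :+ y :* (t :* s) := (:1 :+ y :* t) :* s) ≈-refl _ _ _ ⟩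
    (1# ⊕ x ↑ n ⊗ qint (x ↑ n) m) ⊗ qint x n            ∎

  geometric : ∀ x n → (x ⊖ 1#) ⊗ qint x n ≈ x ↑ n ⊖ 1#
  geometric x zero    = ≈-trans (zeroʳ _) (≈-sym (-‿inverseʳ 1#))
  geometric x (suc n) = begin
    (x ⊖ 1#) ⊗ (1# ⊕ x ⊗ qint x n)           ≈⟨ solve 2 (λ x s → (x :- :1) :* (:1 :+ x :* s) := (x :- :1) :+ x :* ((x :- :1) :* s)) ≈-refl x _ ⟩
    (x ⊖ 1#) ⊕ x ⊗ ((x ⊖ 1#) ⊗ qint x n)    ≈⟨ +-congˡ _ (*-congˡ x (geometric x n)) ⟩
    (x ⊖ 1#) ⊕ x ⊗ (x ↑ n ⊖ 1#)             ≈⟨ solve 2 (λ x y → (x :- :1) :+ x :* (y :- :1) := x :* y :- :1) ≈-refl x _ ⟩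
    x ↑ suc n ⊖ 1#                             ∎

  qint-suc : ∀ x n → qint x (suc n) ≈ qint x n ⊕ x ↑ n
  qint-suc x zero    = solve 1 (λ x → :1 :+ x :* :0 := :0 :+ :1) ≈-refl x
  qint-suc x (suc n) = ≈-trans (+-congˡ 1# (*-congˡ x (qint-suc x n)))
    (solve 3 (λ x s y → :1 :+ x :* (s :+ y) := (:1 :+ x :* s) :+ x :* y) ≈-refl x _ _)

  qint-∑ : ∀ x n → qint x n ≈ ∑ n (x ↑_)
  qint-∑ x zero    = ≈-refl
  qint-∑ x (suc n) = ≈-trans (qint-suc x n) (+-congʳ _ (qint-∑ x n))

  -- Sums with the weights `j(c-j)`

  weight : Carrier → ℕ → Carrier
  weight c j = # j ⊗ (c ⊖ # j)

  -- The factor 6 clears the denominators of `Σ j` and `Σ j²`. The constant `c` is kept apart from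
  -- the number of terms so that the induction on `n` leaves the summands fixed; `c = n = p` gives
  -- `p(p²-1)`.
  ∑-weight : ∀ c n → # 6 ⊗ ∑ n (weight c) ≈
             # 3 ⊗ c ⊗ # n ⊗ (# n ⊖ 1#) ⊖ (# n ⊖ 1#) ⊗ # n ⊗ (# 2 ⊗ # n ⊖ 1#)
  ∑-weight c zero    = solve 1 (λ c → con (+ 6) :* :0 := con (+ 3) :* c :* :0 :* (:0 :- :1) :- (:0 :- :1) :* :0 :* (:2 :* :0 :- :1)) ≈-refl c
  ∑-weight c (suc n) = begin
    # 6 ⊗ (∑ n (weight c) ⊕ weight c n)
      ≈⟨ solve 3 (λ s c N → con (+ 6) :* (s :+ N :* (c :- N)) := con (+ 6) :* s :+ con (+ 6) :* (N :* (c :- N))) ≈-refl _ c (# n) ⟩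
    # 6 ⊗ ∑ n (weight c) ⊕ # 6 ⊗ weight c n
      ≈⟨ +-congʳ _ (∑-weight c n) ⟩
    (# 3 ⊗ c ⊗ # n ⊗ (# n ⊖ 1#) ⊖ (# n ⊖ 1#) ⊗ # n ⊗ (# 2 ⊗ # n ⊖ 1#)) ⊕ # 6 ⊗ weight c n
      ≈⟨ solve 2 (λ c N → (con (+ 3) :* c :* N :* (N :- :1) :- (N :- :1) :* N :* (:2 :* N :- :1)) :+ con (+ 6) :* (N :* (c :- N))
           := closed c (:1 :+ N)) ≈-refl c (# n) ⟩
    # 3 ⊗ c ⊗ (1# ⊕ # n) ⊗ ((1# ⊕ # n) ⊖ 1#) ⊖ ((1# ⊕ # n) ⊖ 1#) ⊗ (1# ⊕ # n) ⊗ (# 2 ⊗ (1# ⊕ # n) ⊖ 1#)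
      ≈⟨ ⊖-cong (*-cong (*-congˡ _ N+1) (⊖-cong N+1 ≈-refl)) (*-cong (*-cong (⊖-cong N+1 ≈-refl) N+1) (⊖-cong (*-congˡ _ N+1) ≈-refl)) ⟩
    # 3 ⊗ c ⊗ # suc n ⊗ (# suc n ⊖ 1#) ⊖ (# suc n ⊖ 1#) ⊗ # suc n ⊗ (# 2 ⊗ # suc n ⊖ 1#)
      ∎
    where
    N+1 : 1# ⊕ # n ≈ # suc n
    N+1 = ≈-sym (#-+ 1 n)
    closed : ∀ {m} (c N : Polynomial m) → Polynomial m
    closed c N = con (+ 3) :* c :* N :* (N :- :1) :- (N :- :1) :* N :* (:2 :* N :- :1)

  -- The partial sums of Σ j(c-j)x^j, cleared of the denominator (1-x)^2. When x^n = 1 ≠ x and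
  -- c = n this says Σ_{j<n} j(n-j)x^j = 2nx/(1-x)^2.
  ∑-weight-↑ : ∀ c x n →
    (1# ⊖ x) ⊗ (1# ⊖ x) ⊗ ∑ n (λ j → weight c j ⊗ x ↑ j) ⊕ x ⊗ (1# ⊕ x) ⊗ qint x n ≈
    c ⊗ x ⊕ x ↑ n ⊗ ((1# ⊖ x) ⊗ # n ⊗ # n ⊕ (# 2 ⊗ x ⊖ c ⊗ (1# ⊖ x)) ⊗ # n ⊖ c ⊗ x)
  ∑-weight-↑ c x zero = solve 2 (λ c x →
    (:1 :- x) :* (:1 :- x) :* :0 :+ x :* (:1 :+ x) :* :0 :=
    c :* x :+ :1 :* ((:1 :- x) :* :0 :* :0 :+ (:2 :* x :- c :* (:1 :- x)) :* :0 :- c :* x)) ≈-refl c x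
  ∑-weight-↑ c x (suc n) = begin
    (1# ⊖ x) ⊗ (1# ⊖ x) ⊗ (S ⊕ weight c n ⊗ y) ⊕ x ⊗ (1# ⊕ x) ⊗ qint x (suc n)
      ≈⟨ +-congˡ _ (*-congˡ _ (qint-suc x n)) ⟩
    (1# ⊖ x) ⊗ (1# ⊖ x) ⊗ (S ⊕ weight c n ⊗ y) ⊕ x ⊗ (1# ⊕ x) ⊗ (qint x n ⊕ y)
      ≈⟨ solve 5 (λ x y S w s → (:1 :- x) :* (:1 :- x) :* (S :+ w :* y) :+ x :* (:1 :+ x) :* (s :+ y)
           := ((:1 :- x) :* (:1 :- x) :* S :+ x :* (:1 :+ x) :* s) :+ ((:1 :- x) :* (:1 :- x) :* w :+ x :* (:1 :+ x)) :* y) ≈-refl x y S _ _ ⟩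
    ((1# ⊖ x) ⊗ (1# ⊖ x) ⊗ S ⊕ x ⊗ (1# ⊕ x) ⊗ qint x n) ⊕ ((1# ⊖ x) ⊗ (1# ⊖ x) ⊗ weight c n ⊕ x ⊗ (1# ⊕ x)) ⊗ y
      ≈⟨ +-congʳ _ (∑-weight-↑ c x n) ⟩
    (c ⊗ x ⊕ y ⊗ ((1# ⊖ x) ⊗ # n ⊗ # n ⊕ (# 2 ⊗ x ⊖ c ⊗ (1# ⊖ x)) ⊗ # n ⊖ c ⊗ x)) ⊕ ((1# ⊖ x) ⊗ (1# ⊖ x) ⊗ weight c n ⊕ x ⊗ (1# ⊕ x)) ⊗ y
      ≈⟨ solve 4 (λ c x y N → (c :* x :+ y :* closed c x N) :+ ((:1 :- x) :* (:1 :- x) :* (N :* (c :- N)) :+ x :* (:1 :+ x)) :* y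
           := c :* x :+ x :* y :* closed c x (:1 :+ N)) ≈-refl c x y (# n) ⟩
    c ⊗ x ⊕ x ↑ suc n ⊗ ((1# ⊖ x) ⊗ (1# ⊕ # n) ⊗ (1# ⊕ # n) ⊕ (# 2 ⊗ x ⊖ c ⊗ (1# ⊖ x)) ⊗ (1# ⊕ # n) ⊖ c ⊗ x)
      ≈⟨ +-congˡ _ (*-congˡ _ (⊖-cong (+-cong (*-cong (*-congˡ _ N+1) N+1) (*-congˡ _ N+1)) ≈-refl)) ⟩
    c ⊗ x ⊕ x ↑ suc n ⊗ ((1# ⊖ x) ⊗ # suc n ⊗ # suc n ⊕ (# 2 ⊗ x ⊖ c ⊗ (1# ⊖ x)) ⊗ # suc n ⊖ c ⊗ x)
      ∎
    where
    S = ∑ n (λ j → weight c j ⊗ x ↑ j)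
    y = x ↑ n
    N+1 : 1# ⊕ # n ≈ # suc n
    N+1 = ≈-sym (#-+ 1 n)
    closed : ∀ {m} (c x N : Polynomial m) → Polynomial m
    closed c x N = (:1 :- x) :* N :* N :+ (:2 :* x :- c :* (:1 :- x)) :* N :- c :* x

  -- q-binomial coefficients from the q-Pascal rule

  qbin : Carrier → ℕ → ℕ → Carrier
  qbin x n       zero    = 1#
  qbin x zero    (suc k) = 0#
  qbin x (suc n) (suc k) = qbin x n k ⊕ x ↑ suc k ⊗ qbin x n (suc k)

  qbin-cong : ∀ {x y} → x ≈ y → ∀ n k → qbin x n k ≈ qbin y n k
  qbin-cong e n       zero    = ≈-refl
  qbin-cong e zero    (suc k) = ≈-refl
  qbin-cong e (suc n) (suc k) = +-cong (qbin-cong e n k) (*-cong (^-congˡ (suc k) e) (qbin-cong e n (suc k)))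

  qbin-< : ∀ x {n k} → n < k → qbin x n k ≈ 0#
  qbin-< x {zero}  {suc k} _         = ≈-refl
  qbin-< x {suc n} {suc k} (s≤s n<k) = begin
    qbin x n k ⊕ x ↑ suc k ⊗ qbin x n (suc k)   ≈⟨ +-cong (qbin-< x n<k) (*-congˡ _ (qbin-< x (ℕₚ.m<n⇒m<1+n n<k))) ⟩
    0# ⊕ x ↑ suc k ⊗ 0#                         ≈⟨ ≈-trans (+-identityˡ _) (zeroʳ _) ⟩
    0#                                             ∎

  qbin-diag : ∀ x n → qbin x n n ≈ 1#
  qbin-diag x zero    = ≈-refl
  qbin-diag x (suc n) = begin
    qbin x n n ⊕ x ↑ suc n ⊗ qbin x n (suc n)   ≈⟨ +-cong (qbin-diag x n) (≈-trans (*-congˡ _ (qbin-< x (ℕₚ.n<1+n n))) (zeroʳ _)) ⟩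
    1# ⊕ 0#                                       ≈⟨ +-identityʳ 1# ⟩
    1#                                             ∎

  -- Both terms of the Pascal rule reduce to `qfactorial x n`, and their coefficients add up to
  -- `[k+1] + x^(k+1) [j+1] = [n+1]`. The complement `j` is an argument of its own to avoid
  -- truncated subtraction.
  qbin-qfactorial : ∀ x n k j → n ≡ k + j → qfactorial x k ⊗ qfactorial x j ⊗ qbin x n k ≈ qfactorial x n
  qbin-qfactorial x n zero j refl =
    solve 1 (λ f → (:1 :* f) :* :1 := f) ≈-refl (qfactorial x j)
  qbin-qfactorial x (suc n) (suc k) zero e with refl ← trans (ℕₚ.suc-injective e) (ℕₚ.+-identityʳ k) = begin
    qfactorial x (suc n) ⊗ 1# ⊗ qbin x (suc n) (suc n)   ≈⟨ *-congˡ _ (qbin-diag x (suc n)) ⟩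
    qfactorial x (suc n) ⊗ 1# ⊗ 1#                       ≈⟨ solve 1 (λ f → f :* :1 :* :1 := f) ≈-refl _ ⟩
    qfactorial x (suc n)                                   ∎
  qbin-qfactorial x (suc n) (suc k) (suc j) e = begin
    ([k+1] ⊗ qfactorial x k) ⊗ ([j+1] ⊗ qfactorial x j) ⊗ (qbin x n k ⊕ x ↑ suc k ⊗ qbin x n (suc k))
      ≈⟨ solve 7 (λ K fk J fj b y c → (K :* fk) :* (J :* fj) :* (b :+ y :* c)
           := K :* (fk :* (J :* fj) :* b) :+ y :* J :* ((K :* fk) :* fj :* c)) ≈-refl
           [k+1] _ [j+1] (qfactorial x j) _ _ _ ⟩
    [k+1] ⊗ (qfactorial x k ⊗ qfactorial x (suc j) ⊗ qbin x n k) ⊕ x ↑ suc k ⊗ [j+1] ⊗ (qfactorial x (suc k) ⊗ qfactorial x j ⊗ qbin x n (suc k))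
      ≈⟨ +-cong (*-congˡ _ (qbin-qfactorial x n k (suc j) (ℕₚ.suc-injective e)))
                (*-congˡ _ (qbin-qfactorial x n (suc k) j (trans (ℕₚ.suc-injective e) (ℕₚ.+-suc k j)))) ⟩
    [k+1] ⊗ qfactorial x n ⊕ x ↑ suc k ⊗ [j+1] ⊗ qfactorial x n
      ≈⟨ solve 4 (λ K y J f → K :* f :+ y :* J :* f := (K :+ y :* J) :* f) ≈-refl [k+1] _ [j+1] _ ⟩
    ([k+1] ⊕ x ↑ suc k ⊗ [j+1]) ⊗ qfactorial x n
      ≈⟨ *-congʳ _ (≈-trans (≈-sym (qint-+ x (suc k) (suc j))) (≈-reflexive (cong (qint x) (sym e)))) ⟩
    qint x (suc n) ⊗ qfactorial x n
      ∎
    where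
    [k+1] = qint x (suc k)
    [j+1] = qint x (suc j)

  -- Consequences of the factorial formula when every `[n+1]` is cancellable

  module _ (x : Carrier) (cancel : ∀ n f → qint x (suc n) ⊗ f ≈ 0# → f ≈ 0#) where

    qfactorial-cancelˡ : ∀ k {f g} → qfactorial x k ⊗ f ≈ qfactorial x k ⊗ g → f ≈ g
    qfactorial-cancelˡ zero {f} {g} e = ≈-trans (≈-sym (*-identityˡ f)) (≈-trans e (*-identityˡ g))
    qfactorial-cancelˡ (suc k) {f} {g} e = qfactorial-cancelˡ k (zero-cancel⇒cancel (qint x (suc k)) (cancel k)
      (≈-trans (≈-sym (*-assoc _ _ f)) (≈-trans e (*-assoc _ _ g))))

    qfactorial²-cancelˡ : ∀ k j {f g} → qfactorial x k ⊗ qfactorial x j ⊗ f ≈ qfactorial x k ⊗ qfactorial x j ⊗ g → f ≈ g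
    qfactorial²-cancelˡ k j {f} {g} e = qfactorial-cancelˡ j (qfactorial-cancelˡ k
      (≈-trans (≈-sym (*-assoc _ _ f)) (≈-trans e (*-assoc _ _ g))))

    qbin-unique : ∀ n k f → k ≤ n → qfactorial x k ⊗ qfactorial x (n ∸ k) ⊗ f ≈ qfactorial x n → f ≈ qbin x n k
    qbin-unique n k f k≤n e = qfactorial²-cancelˡ k (n ∸ k)
      (≈-trans e (≈-sym (qbin-qfactorial x n k (n ∸ k) (sym (ℕₚ.m+[n∸m]≡n k≤n)))))

    qbin-absorption : ∀ n k →
                      qint x (suc k) ⊗ qbin x (suc n) (suc k) ≈ qint x (suc n) ⊗ qbin x n k
    qbin-absorption n k with k ℕₚ.≤? n
    ... | no k≰n = begin
      qint x (suc k) ⊗ qbin x (suc n) (suc k)   ≈⟨ *-congˡ _ (qbin-< x (s≤s n<k)) ⟩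
      qint x (suc k) ⊗ 0#                       ≈⟨ ≈-trans (zeroʳ _) (≈-sym (zeroʳ _)) ⟩
      qint x (suc n) ⊗ 0#                       ≈⟨ *-congˡ _ (qbin-< x n<k) ⟨
      qint x (suc n) ⊗ qbin x n k               ∎
      where n<k = ℕₚ.≰⇒> k≰n
    ... | yes k≤n = qfactorial²-cancelˡ k j (begin
      qfactorial x k ⊗ qfactorial x j ⊗ (qint x (suc k) ⊗ qbin x (suc n) (suc k))
        ≈⟨ solve 4 (λ f g s b → f :* g :* (s :* b) := (s :* f) :* g :* b) ≈-refl _ _ _ _ ⟩
      qfactorial x (suc k) ⊗ qfactorial x j ⊗ qbin x (suc n) (suc k)
        ≈⟨ qbin-qfactorial x (suc n) (suc k) j (cong suc n≡k+j) ⟩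
      qint x (suc n) ⊗ qfactorial x n
        ≈⟨ *-congˡ _ (qbin-qfactorial x n k j n≡k+j) ⟨
      qint x (suc n) ⊗ (qfactorial x k ⊗ qfactorial x j ⊗ qbin x n k)
        ≈⟨ solve 4 (λ f g s b → s :* (f :* g :* b) := f :* g :* (s :* b)) ≈-refl _ _ _ _ ⟩
      qfactorial x k ⊗ qfactorial x j ⊗ (qint x (suc n) ⊗ qbin x n k)
        ∎)
      where
      j = n ∸ k
      n≡k+j : n ≡ k + j
      n≡k+j = sym (ℕₚ.m+[n∸m]≡n k≤n)

    qbin-ratio : ∀ k j →
                 qint x (suc k) ⊗ qbin x (k + suc j) (suc k) ≈ qint x (suc j) ⊗ qbin x (k + suc j) k
    qbin-ratio k j = qfactorial²-cancelˡ k j (begin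
      qfactorial x k ⊗ qfactorial x j ⊗ (qint x (suc k) ⊗ qbin x (k + suc j) (suc k))
        ≈⟨ solve 4 (λ f g s b → f :* g :* (s :* b) := (s :* f) :* g :* b) ≈-refl _ _ _ _ ⟩
      qfactorial x (suc k) ⊗ qfactorial x j ⊗ qbin x (k + suc j) (suc k)
        ≈⟨ qbin-qfactorial x (k + suc j) (suc k) j (ℕₚ.+-suc k j) ⟩
      qfactorial x (k + suc j)
        ≈⟨ qbin-qfactorial x (k + suc j) k (suc j) refl ⟨
      qfactorial x k ⊗ qfactorial x (suc j) ⊗ qbin x (k + suc j) k
        ≈⟨ solve 4 (λ f g s b → f :* (s :* g) :* b := f :* g :* (s :* b)) ≈-refl _ _ _ _ ⟩
      qfactorial x k ⊗ qfactorial x j ⊗ (qint x (suc j) ⊗ qbin x (k + suc j) k)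
        ∎)

    -- The mirrored Pascal rule, with the weight on the other summand. It agrees with the defining
    -- one because neighbouring coefficients `b`, `c` satisfy `(x^(k+1) - 1) c = (x - 1) [k+1] c =
    -- (x - 1) [j+1] b = (x^(j+1) - 1) b`.
    qbin-pascal′ : ∀ k j →
                   qbin x (suc (k + j)) (suc k) ≈ qbin x (k + j) (suc k) ⊕ x ↑ j ⊗ qbin x (k + j) k
    qbin-pascal′ k zero rewrite ℕₚ.+-identityʳ k = begin
      qbin x (suc k) (suc k)                       ≈⟨ qbin-diag x (suc k) ⟩
      1#                                           ≈⟨ solve 0 (:1 := :0 :+ :1 :* :1) ≈-refl ⟩
      0# ⊕ 1# ⊗ 1#                               ≈⟨ +-cong (qbin-< x (ℕₚ.n<1+n k)) (*-congˡ 1# (qbin-diag x k)) ⟨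
      qbin x k (suc k) ⊕ 1# ⊗ qbin x k k         ∎
    qbin-pascal′ k (suc j) = begin
      b ⊕ x ↑ suc k ⊗ c
        ≈⟨ solve 3 (λ b y c → b :+ y :* c := c :+ b :+ (y :- :1) :* c) ≈-refl b _ c ⟩
      c ⊕ b ⊕ (x ↑ suc k ⊖ 1#) ⊗ c
        ≈⟨ +-congˡ _ (*-congʳ c (geometric x (suc k))) ⟨
      c ⊕ b ⊕ (x ⊖ 1#) ⊗ qint x (suc k) ⊗ c
        ≈⟨ +-congˡ _ (*-assoc (x ⊖ 1#) _ c) ⟩
      c ⊕ b ⊕ (x ⊖ 1#) ⊗ (qint x (suc k) ⊗ c)
        ≈⟨ +-congˡ _ (*-congˡ (x ⊖ 1#) (qbin-ratio k j)) ⟩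
      c ⊕ b ⊕ (x ⊖ 1#) ⊗ (qint x (suc j) ⊗ b)
        ≈⟨ +-congˡ _ (*-assoc (x ⊖ 1#) _ b) ⟨
      c ⊕ b ⊕ (x ⊖ 1#) ⊗ qint x (suc j) ⊗ b
        ≈⟨ +-congˡ _ (*-congʳ b (geometric x (suc j))) ⟩
      c ⊕ b ⊕ (x ↑ suc j ⊖ 1#) ⊗ b
        ≈⟨ solve 3 (λ b y c → c :+ b :+ (y :- :1) :* b := c :+ y :* b) ≈-refl b _ c ⟩
      c ⊕ x ↑ suc j ⊗ b
        ∎
      where
      b = qbin x (k + suc j) k
      c = qbin x (k + suc j) (suc k)

    -- The q-Vandermonde formula with `qbin x m i` for `qbin x m (m ∸ i)`, which makes every lower
    -- index `k + i`. In the induction on `m` the defining Pascal rule opens the left side, and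
    -- `qbin-pascal′` reassembles the right side.
    qbin-vandermonde : ∀ m n k → qbin x (n + m) (k + m) ≈
                       ∑ (suc m) (λ i → qbin x m i ⊗ (x ↑ (i * (k + i)) ⊗ qbin x n (k + i)))
    qbin-vandermonde zero n k = ≈-trans (≈-reflexive (cong (λ n → qbin x n (k + 0)) (ℕₚ.+-identityʳ n)))
      (solve 1 (λ b → b := :0 :+ :1 :* (:1 :* b)) ≈-refl _)
    qbin-vandermonde (suc m) n k = begin
      qbin x (n + suc m) (k + suc m)
        ≈⟨ ≈-reflexive (cong₂ (qbin x) (ℕₚ.+-suc n m) (ℕₚ.+-suc k m)) ⟩
      qbin x (n + m) (k + m) ⊕ y ⊗ qbin x (n + m) (suc k + m)
        ≈⟨ +-cong (qbin-vandermonde m n k) (*-congˡ y (qbin-vandermonde m n (suc k))) ⟩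
      ∑ (suc m) (λ i → qbin x m i ⊗ t i) ⊕ y ⊗ ∑ (suc m) (λ i → qbin x m i ⊗ t′ i)
        ≈⟨ +-cong extend (≈-sym (∑-*ˡ (suc m) y _)) ⟩
      (qbin x m 0 ⊗ t 0 ⊕ ∑ (suc m) (λ i → qbin x m (suc i) ⊗ t (suc i))) ⊕ ∑ (suc m) (λ i → y ⊗ (qbin x m i ⊗ t′ i))
        ≈⟨ ≈-trans (+-assoc _ _ _) (+-congˡ _ (≈-sym (∑-+ (suc m) _ _))) ⟩
      qbin x m 0 ⊗ t 0 ⊕ ∑ (suc m) (λ i → qbin x m (suc i) ⊗ t (suc i) ⊕ y ⊗ (qbin x m i ⊗ t′ i))
        ≈⟨ +-congˡ _ (∑-cong (suc m) (λ i i<1+m → ≈-sym (term i (ℕₚ.≤-pred i<1+m)))) ⟩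
      qbin x (suc m) 0 ⊗ t 0 ⊕ ∑ (suc m) (λ i → qbin x (suc m) (suc i) ⊗ t (suc i))
        ≈⟨ ∑-head (suc m) (λ i → qbin x (suc m) i ⊗ t i) ⟨
      ∑ (suc (suc m)) (λ i → qbin x (suc m) i ⊗ t i)
        ∎
      where
      y = x ↑ suc (k + m)
      t t′ : ℕ → Carrier
      t  i = x ↑ (i * (k + i)) ⊗ qbin x n (k + i)
      t′ i = x ↑ (i * (suc k + i)) ⊗ qbin x n (suc k + i)

      -- The vanishing term `i = m + 1` is added so that, after the head is split off, this sum has
      -- the same range as the other one.
      extend : ∑ (suc m) (λ i → qbin x m i ⊗ t i) ≈ qbin x m 0 ⊗ t 0 ⊕ ∑ (suc m) (λ i → qbin x m (suc i) ⊗ t (suc i))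
      extend = begin
        ∑ (suc m) (λ i → qbin x m i ⊗ t i)
          ≈⟨ +-identityʳ _ ⟨
        ∑ (suc m) (λ i → qbin x m i ⊗ t i) ⊕ 0#
          ≈⟨ +-congˡ _ (≈-trans (*-congʳ _ (qbin-< x (ℕₚ.n<1+n m))) (zeroˡ _)) ⟨
        ∑ (suc (suc m)) (λ i → qbin x m i ⊗ t i)
          ≈⟨ ∑-head (suc m) (λ i → qbin x m i ⊗ t i) ⟩
        qbin x m 0 ⊗ t 0 ⊕ ∑ (suc m) (λ i → qbin x m (suc i) ⊗ t (suc i))
          ∎

      exponent : ∀ k i d → d + suc i * (k + suc i) ≡ suc (k + (i + d)) + i * (suc k + i)
      exponent = solve-∀

      -- The weight `x^(m-i)` of the mirrored rule turns the exponent in `t (suc i)` into the one in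
      -- `y ⊗ t′ i`.
      term : ∀ i → i ≤ m → qbin x (suc m) (suc i) ⊗ t (suc i) ≈ qbin x m (suc i) ⊗ t (suc i) ⊕ y ⊗ (qbin x m i ⊗ t′ i)
      term i i≤m = begin
        qbin x (suc m) (suc i) ⊗ t (suc i)
          ≈⟨ *-congʳ _ (subst (λ m → qbin x (suc m) (suc i) ≈ qbin x m (suc i) ⊕ x ↑ d ⊗ qbin x m i) i+d≡m (qbin-pascal′ i d)) ⟩
        (qbin x m (suc i) ⊕ x ↑ d ⊗ qbin x m i) ⊗ t (suc i)
          ≈⟨ solve 5 (λ a y b z c → (a :+ y :* b) :* (z :* c) := a :* (z :* c) :+ b :* (y :* z) :* c) ≈-refl _ _ _ _ _ ⟩
        qbin x m (suc i) ⊗ t (suc i) ⊕ qbin x m i ⊗ (x ↑ d ⊗ x ↑ (suc i * (k + suc i))) ⊗ qbin x n (k + suc i)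
          ≈⟨ +-congˡ _ (*-cong (*-congˡ _ power) (≈-reflexive (cong (qbin x n) (ℕₚ.+-suc k i)))) ⟩
        qbin x m (suc i) ⊗ t (suc i) ⊕ qbin x m i ⊗ (y ⊗ x ↑ (i * (suc k + i))) ⊗ qbin x n (suc k + i)
          ≈⟨ +-congˡ _ (solve 4 (λ b y z c → b :* (y :* z) :* c := y :* (b :* (z :* c))) ≈-refl _ _ _ _) ⟩
        qbin x m (suc i) ⊗ t (suc i) ⊕ y ⊗ (qbin x m i ⊗ t′ i)
          ∎
        where
        d = m ∸ i
        i+d≡m : i + d ≡ m
        i+d≡m = ℕₚ.m+[n∸m]≡n i≤m
        power : x ↑ d ⊗ x ↑ (suc i * (k + suc i)) ≈ y ⊗ x ↑ (i * (suc k + i))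
        power = ≈-trans (≈-sym (^-homo-* x d _)) (≈-trans
          (≈-reflexive (cong (x ↑_) (trans (exponent k i d) (cong (λ m → suc (k + m) + i * (suc k + i)) i+d≡m))))
          (^-homo-* x (suc (k + m)) _))

-- Congruences modulo powers of [p]_q
module Ljunggren
  (R : CommutativeRing 0ℓ 0ℓ)
  (ι : ℤ-rawRing -Raw-AlmostCommutative⟶ fromCommutativeRing R)
  where

  open QAnalogues R ι

  module Congruence (Φ : Carrier) where

    infix 4 _≅[_]_
    -- The quotient is kept as data because the theorem has to exhibit one.
    record _≅[_]_ (f : Carrier) (n : ℕ) (g : Carrier) : Set where
      constructor _by_
      field
        quotient : Carrier
        equality : f ≈ g ⊕ Φ ↑ n ⊗ quotient
    open _≅[_]_ public

    module _ {n : ℕ} where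

      ≈⇒≅ : ∀ {f g} → f ≈ g → f ≅[ n ] g
      ≈⇒≅ {f} {g} e = 0# by ≈-trans e (solve 2 (λ g m → g := g :+ m :* :0) ≈-refl g (Φ ↑ n))

      ≅-refl : ∀ {f} → f ≅[ n ] f
      ≅-refl = ≈⇒≅ ≈-refl

      ≅-sym : ∀ {f g} → f ≅[ n ] g → g ≅[ n ] f
      ≅-sym {f} {g} (h by e) = (0# ⊖ h) by ≈-trans
        (solve 3 (λ g m h → g := (g :+ m :* h) :+ m :* (:0 :- h)) ≈-refl g (Φ ↑ n) h) (+-congʳ _ (≈-sym e))

      ≅-trans : ∀ {f g k} → f ≅[ n ] g → g ≅[ n ] k → f ≅[ n ] k
      ≅-trans {f} {g} {k} (h by e) (h′ by e′) = (h ⊕ h′) by ≈-trans e (≈-trans (+-congʳ _ e′)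
        (solve 4 (λ k m h h′ → (k :+ m :* h′) :+ m :* h := k :+ m :* (h :+ h′)) ≈-refl k (Φ ↑ n) h h′))

      ≅-+ : ∀ {f g f′ g′} → f ≅[ n ] g → f′ ≅[ n ] g′ → f ⊕ f′ ≅[ n ] g ⊕ g′
      ≅-+ {g = g} {g′ = g′} (h by e) (h′ by e′) = (h ⊕ h′) by ≈-trans (+-cong e e′)
        (solve 5 (λ g g′ m h h′ → (g :+ m :* h) :+ (g′ :+ m :* h′) := g :+ g′ :+ m :* (h :+ h′)) ≈-refl g g′ (Φ ↑ n) h h′)

      ≅-* : ∀ {f g f′ g′} → f ≅[ n ] g → f′ ≅[ n ] g′ → f ⊗ f′ ≅[ n ] g ⊗ g′
      ≅-* {g = g} {g′ = g′} (h by e) (h′ by e′) = (h ⊗ g′ ⊕ (g ⊗ h′ ⊕ h ⊗ (Φ ↑ n ⊗ h′))) by ≈-trans (*-cong e e′)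
        (solve 5 (λ g g′ m h h′ → (g :+ m :* h) :* (g′ :+ m :* h′)
          := g :* g′ :+ m :* (h :* g′ :+ (g :* h′ :+ h :* (m :* h′)))) ≈-refl g g′ (Φ ↑ n) h h′)

      ≅-*ˡ : ∀ c {f g} → f ≅[ n ] g → c ⊗ f ≅[ n ] c ⊗ g
      ≅-*ˡ c = ≅-* ≅-refl

      ≅-*ʳ : ∀ c {f g} → f ≅[ n ] g → f ⊗ c ≅[ n ] g ⊗ c
      ≅-*ʳ c e = ≅-* e ≅-refl

      ≅-+ˡ : ∀ c {f g} → f ≅[ n ] g → c ⊕ f ≅[ n ] c ⊕ g
      ≅-+ˡ c = ≅-+ ≅-refl

      ≅-⊖ : ∀ {f g f′ g′} → f ≅[ n ] g → f′ ≅[ n ] g′ → f ⊖ f′ ≅[ n ] g ⊖ g′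
      ≅-⊖ {f} {g} {f′} {g′} e e′ = ≅-trans (≈⇒≅ (solve 2 (λ f f′ → f :- f′ := f :+ (:0 :- :1) :* f′) ≈-refl f f′))
        (≅-trans (≅-+ e (≅-*ˡ _ e′)) (≈⇒≅ (solve 2 (λ f f′ → f :+ (:0 :- :1) :* f′ := f :- f′) ≈-refl g g′)))

      ≅-difference : ∀ {f g} → f ⊖ g ≅[ n ] 0# → f ≅[ n ] g
      ≅-difference {f} {g} (h by e) = h by (≈-trans (solve 2 (λ f g → f := g :+ (f :- g)) ≈-refl f g)
        (+-congˡ g (≈-trans e (+-identityˡ _))))

      ≅-zero : ∀ {f g} → f ≅[ n ] g → f ⊖ g ≅[ n ] 0#
      ≅-zero {f} {g} e = ≅-trans (≅-⊖ e ≅-refl) (≈⇒≅ (-‿inverseʳ g))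

      ≅-∑ : ∀ m {f g} → (∀ i → i < m → f i ≅[ n ] g i) → ∑ m f ≅[ n ] ∑ m g
      ≅-∑ zero    e = ≅-refl
      ≅-∑ (suc m) e = ≅-+ (≅-∑ m (λ i i<m → e i (ℕₚ.m<n⇒m<1+n i<m))) (e m (ℕₚ.n<1+n m))

      ≅-↑ : ∀ m {f g} → f ≅[ n ] g → f ↑ m ≅[ n ] g ↑ m
      ≅-↑ zero    e = ≅-refl
      ≅-↑ (suc m) e = ≅-* e (≅-↑ m e)

    -- The way to raise the modulus: an identity known modulo a low power of Φ is multiplied by a
    -- factor already divisible by Φ^m.
    ≅-scale : ∀ m n {u f g} → u ≅[ m ] 0# → f ≅[ n ] g → u ⊗ f ≅[ m + n ] u ⊗ g
    ≅-scale m n {u} {f} {g} (v by d) (h by e) = (v ⊗ h) by (begin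
      u ⊗ f                                ≈⟨ *-congˡ u e ⟩
      u ⊗ (g ⊕ Φ ↑ n ⊗ h)                  ≈⟨ solve 4 (λ u g y h → u :* (g :+ y :* h) := u :* g :+ u :* (y :* h)) ≈-refl u g _ h ⟩
      u ⊗ g ⊕ u ⊗ (Φ ↑ n ⊗ h)              ≈⟨ +-congˡ _ (*-congʳ _ d) ⟩
      u ⊗ g ⊕ (0# ⊕ Φ ↑ m ⊗ v) ⊗ (Φ ↑ n ⊗ h)
        ≈⟨ solve 5 (λ c y v z h → c :+ (:0 :+ y :* v) :* (z :* h) := c :+ (y :* z) :* (v :* h)) ≈-refl _ (Φ ↑ m) v _ h ⟩
      u ⊗ g ⊕ (Φ ↑ m ⊗ Φ ↑ n) ⊗ (v ⊗ h)    ≈⟨ +-congˡ _ (*-congʳ _ (≈-sym (^-homo-* Φ m n))) ⟩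
      u ⊗ g ⊕ Φ ↑ (m + n) ⊗ (v ⊗ h)        ∎)
      where open SetoidReasoning setoid

    ≅-scale-0 : ∀ m n {u f} → u ≅[ m ] 0# → f ≅[ n ] 0# → u ⊗ f ≅[ m + n ] 0#
    ≅-scale-0 m n {u} d e = ≅-trans (≅-scale m n d e) (≈⇒≅ (zeroʳ u))

    Φ≅0 : Φ ≅[ 1 ] 0#
    Φ≅0 = 1# by solve 1 (λ y → y := :0 :+ (y :* :1) :* :1) ≈-refl Φ

    ≅-setoid : ℕ → Setoid _ _
    ≅-setoid n = record { Carrier = Carrier ; _≈_ = _≅[ n ]_
      ; isEquivalence = record { refl = ≅-refl ; sym = ≅-sym ; trans = ≅-trans } }

  module _ (q : Carrier) (p′ : ℕ)
    (qint-cancel : ∀ n f → qint q (suc n) ⊗ f ≈ 0# → f ≈ 0#)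
    (coprime : ∀ i → i < p′ → Coprime (suc i) (suc p′))
    where

    p : ℕ
    p = suc p′

    [_] : ℕ → Carrier
    [ n ] = qint q n

    B : ℕ → ℕ → Carrier
    B = qbin q

    Φ : Carrier
    Φ = [ p ]

    open Congruence Φ

    -- q-integers and powers of `q` modulo Φ

    [n*p]≅0 : ∀ n → [ n * p ] ≅[ 1 ] 0#
    [n*p]≅0 n = ≅-trans (≈⇒≅ (qint-* q n p)) (≅-trans (≅-*ˡ _ Φ≅0) (≈⇒≅ (zeroʳ _)))

    q^p≅1 : q ↑ p ≅[ 1 ] 1#
    q^p≅1 = ≅-difference (≅-trans (≈⇒≅ (≈-sym (geometric q p))) (≅-trans (≅-*ˡ _ Φ≅0) (≈⇒≅ (zeroʳ _))))

    1↑ : ∀ n → 1# ↑ n ≈ 1#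
    1↑ zero    = ≈-refl
    1↑ (suc n) = ≈-trans (*-identityˡ _) (1↑ n)

    q^p*n≅1 : ∀ n → q ↑ (p * n) ≅[ 1 ] 1#
    q^p*n≅1 n = ≅-trans (≈⇒≅ (≈-sym (^-assocʳ q p n))) (≅-trans (≅-↑ n q^p≅1) (≈⇒≅ (1↑ n)))

    q^n*p≅1 : ∀ n → q ↑ (n * p) ≅[ 1 ] 1#
    q^n*p≅1 n = subst (λ m → q ↑ m ≅[ 1 ] 1#) (ℕₚ.*-comm p n) (q^p*n≅1 n)

    qint≅# : ∀ {x} n → x ≅[ 1 ] 1# → qint x n ≅[ 1 ] # n
    qint≅# zero    e = ≅-refl
    qint≅# (suc n) e = ≅-trans (≅-+ˡ 1# (≅-trans (≅-* e (qint≅# n e)) (≈⇒≅ (*-identityˡ _)))) (≈⇒≅ (≈-sym (#-+ 1 n)))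

    -- The factorisation `[np] = [n]_(q^p) Φ` carries an explicit Φ, so `[n]_(q^p) ≡ n` modulo Φ is
    -- precise enough.
    [n*p]≅ : ∀ n → [ n * p ] ≅[ 2 ] Φ ⊗ # n
    [n*p]≅ n = ≅-trans (≈⇒≅ (≈-trans (qint-* q n p) (*-comm _ _))) (≅-scale 1 1 Φ≅0 (qint≅# n q^p≅1))

    [n*p+k]≅ : ∀ n k → [ n * p + k ] ≅[ 1 ] [ k ]
    [n*p+k]≅ n k = ≅-trans (≈⇒≅ (qint-+ q (n * p) k)) (≅-trans (≅-+ ([n*p]≅0 n) (≅-*ʳ _ (q^n*p≅1 n)))
      (≈⇒≅ (solve 1 (λ s → :0 :+ :1 :* s := s) ≈-refl [ k ])))

    -- Bézout's `x k = 1 + y p` gives `f = [xk] f - q [yp] f`. The first term is a multiple of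
    -- `[k] f`; in the second, `[yp]` supplies one factor Φ and `f` itself the other `n`.
    coprime-cancel : ∀ k n {f} → Coprime k p → f ≅[ n ] 0# → [ k ] ⊗ f ≅[ suc n ] 0# → f ≅[ suc n ] 0#
    coprime-cancel k n {f} k⊥p f≅0 kf≅0 = go (Coprimality.coprime-Bézout k⊥p)
      where
      unitary : ∀ {u v} → 1# ⊕ q ⊗ v ≈ u → u ⊗ f ≅[ suc n ] 0# → v ⊗ f ≅[ suc n ] 0# → f ≅[ suc n ] 0#
      unitary {u} {v} e uf≅0 vf≅0 = ≅-trans (≈⇒≅ (≈-trans
        (solve 3 (λ q v f → f := (:1 :+ q :* v) :* f :- q :* (v :* f)) ≈-refl q v f) (⊖-cong (*-congʳ f e) ≈-refl)))
        (≅-trans (≅-⊖ uf≅0 (≅-*ˡ q vf≅0)) (≈⇒≅ (solve 1 (λ q → :0 :- q :* :0 := :0) ≈-refl q)))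
      [xk]f≅0 : ∀ x → [ x * k ] ⊗ f ≅[ suc n ] 0#
      [xk]f≅0 x = ≅-trans (≈⇒≅ (≈-trans (*-congʳ f (qint-* q x k)) (*-assoc _ _ f)))
                    (≅-trans (≅-*ˡ _ kf≅0) (≈⇒≅ (zeroʳ _)))
      [yp]f≅0 : ∀ y → [ y * p ] ⊗ f ≅[ suc n ] 0#
      [yp]f≅0 y = ≅-scale-0 1 n ([n*p]≅0 y) f≅0
      go : Bézout.Identity 1 k p → f ≅[ suc n ] 0#
      -- `[ 1 + n ]` reduces to `1# ⊕ q ⊗ [ n ]`, so Bézout's equation is the required relation; the
      -- other sign exchanges the two multiples.
      go (Bézout.+- x y eq) = unitary (≈-reflexive (cong [_] eq)) ([xk]f≅0 x) ([yp]f≅0 y)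
      go (Bézout.-+ x y eq) = unitary (≈-reflexive (cong [_] eq)) ([yp]f≅0 y) ([xk]f≅0 x)

    coprime-cancel₁ : ∀ k {f} → Coprime k p → [ k ] ⊗ f ≅[ 1 ] 0# → f ≅[ 1 ] 0#
    coprime-cancel₁ k {f} k⊥p = coprime-cancel k 0 k⊥p (f by solve 1 (λ f → f := :0 :+ :1 :* f) ≈-refl f)

    coprime-mod : ∀ b k → k < p′ → Coprime (b * p + suc k) p
    coprime-mod zero    k k<p′ = coprime k k<p′
    coprime-mod (suc b) k k<p′ = subst (λ n → Coprime n p)
      (sym (ℕₚ.+-assoc p (b * p) (suc k)))
      (Coprimality.coprime-+ (coprime-mod b k k<p′))

    coprime-mod′ : ∀ b k → k < p′ → Coprime (suc (b * p + k)) p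
    coprime-mod′ b k k<p′ = subst (λ n → Coprime n p) (ℕₚ.+-suc (b * p) k) (coprime-mod b k k<p′)

    -- The counterpart of `Σ_(j<p) ζ^(kj) = 0`: the product `[k] [p]_(q^k) = [kp]` is a multiple of
    -- Φ, and `[k]` cancels.
    qint-q^k≅0 : ∀ k → Coprime k p → qint (q ↑ k) p ≅[ 1 ] 0#
    qint-q^k≅0 k k⊥p = coprime-cancel₁ k k⊥p (≅-trans
      (≈⇒≅ (≈-trans (*-comm _ _) (≈-trans (≈-sym (qint-* q p k)) (≈-reflexive (cong [_] (ℕₚ.*-comm p k))))))
      ([n*p]≅0 k))

    -- q-binomial coefficients modulo Φ and Φ²

    suc-[a*p+p′] : ∀ a → suc (a * p + p′) ≡ suc a * p
    suc-[a*p+p′] a = cong suc (ℕₚ.+-comm (a * p) p′)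

    B-absorb : ∀ a k → [ suc k ] ⊗ B (suc a * p) (suc k) ≈ [ suc a * p ] ⊗ B (a * p + p′) k
    B-absorb a k = subst (λ n → [ suc k ] ⊗ B n (suc k) ≈ [ n ] ⊗ B (a * p + p′) k) (suc-[a*p+p′] a)
      (qbin-absorption q qint-cancel (a * p + p′) k)

    -- By absorption `[k+1] B(ap,k+1)` is a multiple of `[ap]`, hence of Φ, and `[k+1]` cancels.
    B-coprime : ∀ a k → Coprime (suc k) p → B (a * p) (suc k) ≅[ 1 ] 0#
    B-coprime zero    k k⊥p = ≅-refl
    B-coprime (suc a) k k⊥p = coprime-cancel₁ (suc k) k⊥p (≅-trans (≈⇒≅ (B-absorb a k))
      (≅-trans (≅-*ʳ _ ([n*p]≅0 (suc a))) (≈⇒≅ (zeroˡ _))))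

    middle : ℕ → ℕ → ℕ → Carrier
    middle a b k = B p (suc k) ⊗ (q ↑ (suc k * (b * p + suc k)) ⊗ B (a * p) (b * p + suc k))

    Bp≅0 : ∀ k → k < p′ → B p (suc k) ≅[ 1 ] 0#
    Bp≅0 k k<p′ = subst (λ n → B n (suc k) ≅[ 1 ] 0#) (ℕₚ.*-identityˡ p) (B-coprime 1 k (coprime k k<p′))

    B-vandermonde : ∀ a b → B (suc a * p) (suc b * p) ≈
      B (a * p) (b * p) ⊕ ∑ p′ (middle a b) ⊕ q ↑ (p * (suc b * p)) ⊗ B (a * p) (suc b * p)
    B-vandermonde a b = begin
      B (p + a * p) (p + b * p)        ≈⟨ ≈-reflexive (cong₂ B (ℕₚ.+-comm p (a * p)) (ℕₚ.+-comm p (b * p))) ⟩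
      B (a * p + p) (b * p + p)        ≈⟨ qbin-vandermonde q qint-cancel p (a * p) (b * p) ⟩
      ∑ p F ⊕ F p                      ≈⟨ +-congʳ _ (∑-head p′ F) ⟩
      F 0 ⊕ ∑ p′ (middle a b) ⊕ F p
        ≈⟨ +-cong (+-congʳ _ (≈-trans (solve 1 (λ b → :1 :* (:1 :* b) := b) ≈-refl _)
              (≈-reflexive (cong (B (a * p)) (ℕₚ.+-identityʳ (b * p))))))
            (≈-trans (*-congʳ _ (qbin-diag q p)) (≈-trans (*-identityˡ _)
              (≈-reflexive (cong (λ k → q ↑ (p * k) ⊗ B (a * p) k) (ℕₚ.+-comm (b * p) p))))) ⟩
      B (a * p) (b * p) ⊕ ∑ p′ (middle a b) ⊕ q ↑ (p * (suc b * p)) ⊗ B (a * p) (suc b * p) ∎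
      where
      open SetoidReasoning setoid
      F : ℕ → Carrier
      F i = B p i ⊗ (q ↑ (i * (b * p + i)) ⊗ B (a * p) (b * p + i))

    #C : ∀ a b → # (suc a C suc b) ≈ # (a C b) ⊕ # (a C suc b)
    #C a b = ≈-trans (≈-reflexive (cong #_ (sym (nCk+nC[k+1]≡[n+1]C[k+1] a b)))) (#-+ (a C b) (a C suc b))

    -- Modulo Φ the middle terms vanish and the remaining power of `q` is 1, so the Vandermonde
    -- formula degenerates to Pascal's rule.
    B-multiples : ∀ a b → B (a * p) (b * p) ≅[ 1 ] # (a C b)
    B-multiples a       zero    = ≅-refl
    B-multiples zero    (suc b) = ≅-refl
    B-multiples (suc a) (suc b) = begin
      B (suc a * p) (suc b * p)
        ≈⟨ ≈⇒≅ (B-vandermonde a b) ⟩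
      B (a * p) (b * p) ⊕ ∑ p′ (middle a b) ⊕ q ↑ (p * (suc b * p)) ⊗ B (a * p) (suc b * p)
        ≈⟨ ≅-+ (≅-+ (B-multiples a b) (≅-∑ p′ (λ k k<p′ → ≅-trans (≅-*ʳ _ (Bp≅0 k k<p′)) (≈⇒≅ (zeroˡ _)))))
               (≅-* (q^p*n≅1 (suc b * p)) (B-multiples a (suc b))) ⟩
      # (a C b) ⊕ ∑ p′ (λ _ → 0#) ⊕ 1# ⊗ # (a C suc b)
        ≈⟨ ≈⇒≅ (≈-trans (+-congʳ _ (+-congˡ _ (∑-0 p′))) (solve 2 (λ c d → c :+ :0 :+ :1 :* d := c :+ d) ≈-refl _ _)) ⟩
      # (a C b) ⊕ # (a C suc b)
        ≈⟨ ≈⇒≅ (#C a b) ⟨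
      # (suc a C suc b) ∎
      where open SetoidReasoning (≅-setoid 1)

    -- `q^(j(p-1))` inverts `q^j` modulo Φ.
    q-cancel : ∀ j {f} → q ↑ j ⊗ f ≅[ 1 ] 0# → f ≅[ 1 ] 0#
    q-cancel j {f} e = begin
      f                               ≈⟨ ≈⇒≅ (*-identityˡ f) ⟨
      1# ⊗ f                          ≈⟨ ≅-*ʳ f (q^n*p≅1 j) ⟨
      q ↑ (j * p) ⊗ f                 ≈⟨ ≈⇒≅ (*-congʳ f (≈-trans (≈-reflexive (cong (q ↑_) (trans (ℕₚ.*-suc j p′) (ℕₚ.+-comm j (j * p′))))) (^-homo-* q (j * p′) j))) ⟩
      (q ↑ (j * p′) ⊗ q ↑ j) ⊗ f      ≈⟨ ≈⇒≅ (*-assoc _ _ f) ⟩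
      q ↑ (j * p′) ⊗ (q ↑ j ⊗ f)      ≈⟨ ≅-*ˡ _ e ⟩
      q ↑ (j * p′) ⊗ 0#               ≈⟨ ≈⇒≅ (zeroʳ _) ⟩
      0#                              ∎
      where open SetoidReasoning (≅-setoid 1)

    -- For `k < p` this is `(-1)^k q^(-k(k+1)/2)` modulo Φ; `u-step` expresses that without signs or
    -- negative exponents.
    u : ℕ → Carrier
    u = B p′

    -- The left side is `B p (suc k)` by the definition of `qbin`.
    u-step : ∀ k → k < p′ → u k ⊕ q ↑ suc k ⊗ u (suc k) ≅[ 1 ] 0#
    u-step k k<p′ = Bp≅0 k k<p′

    -- The Pascal expansion of `B((a+1)p, bp+k+1)`, a multiple of Φ, with `q^(bp)` replaced by 1.
    -- The result is the recurrence of `u-step`.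
    B-step : ∀ a b k → k < p′ →
             B (a * p + p′) (b * p + k) ⊕ q ↑ suc k ⊗ B (a * p + p′) (suc (b * p + k)) ≅[ 1 ] 0#
    B-step a b k k<p′ = begin
      B n (b * p + k) ⊕ q ↑ suc k ⊗ B n (suc (b * p + k))
        ≈⟨ ≅-+ˡ _ (≅-*ʳ _ (≈⇒≅ (*-identityˡ _))) ⟨
      B n (b * p + k) ⊕ (1# ⊗ q ↑ suc k) ⊗ B n (suc (b * p + k))
        ≈⟨ ≅-+ˡ _ (≅-*ʳ _ (≅-*ʳ _ (q^n*p≅1 b))) ⟨
      B n (b * p + k) ⊕ (q ↑ (b * p) ⊗ q ↑ suc k) ⊗ B n (suc (b * p + k))
        ≈⟨ ≈⇒≅ (+-congˡ _ (*-congʳ _ (≈-trans (≈-sym (^-homo-* q (b * p) (suc k))) (≈-reflexive (cong (q ↑_) (ℕₚ.+-suc (b * p) k)))))) ⟩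
      B (suc n) (suc (b * p + k))
        ≈⟨ ≈⇒≅ (≈-reflexive (cong (λ n → B n (suc (b * p + k))) (suc-[a*p+p′] a))) ⟩
      B (suc a * p) (suc (b * p + k))
        ≈⟨ B-coprime (suc a) (b * p + k) (coprime-mod′ b k k<p′) ⟩
      0# ∎
      where
      n = a * p + p′
      open SetoidReasoning (≅-setoid 1)

    -- q-Lucas for an upper index with last digit `p - 1`. In `k` both sides obey the same
    -- first-order recurrence, whose coefficient `q^(k+1)` is a unit, so agreement passes from `k`
    -- to `k + 1`.
    B-lucas : ∀ a b k → k ≤ p′ → B (a * p + p′) (b * p + k) ≅[ 1 ] # (a C b) ⊗ u k
    B-lucas a zero zero _ = ≈⇒≅ (≈-sym (*-identityˡ 1#))
    -- The last digit wraps around: Pascal's rule for `B((a+1)p, (b+1)p)`, known from `B-multiples`,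
    -- links this value to the one for `b` with last digit `p′`.
    B-lucas a (suc b) zero _ = ≅-difference (begin
      B n (suc b * p + 0) ⊖ # (a C suc b) ⊗ 1#
        ≈⟨ ≈⇒≅ (⊖-cong (≈-reflexive (cong (B n) (ℕₚ.+-identityʳ (suc b * p)))) (*-identityʳ _)) ⟩
      B n (suc b * p) ⊖ # (a C suc b)
        ≈⟨ ≅-⊖ (≅-trans (≈⇒≅ (≈-sym (*-identityˡ _))) (≅-*ʳ _ (≅-sym (q^n*p≅1 (suc b))))) ≅-refl ⟩
      q ↑ (suc b * p) ⊗ B n (suc b * p) ⊖ # (a C suc b)
        ≈⟨ ≈⇒≅ (solve 4 (λ x y c d → y :- d := (x :+ y) :- (x :- c) :- (c :+ d)) ≈-refl (B n (p′ + b * p)) _ (# (a C b)) _) ⟩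
      B (suc n) (suc (p′ + b * p)) ⊖ (B n (p′ + b * p) ⊖ # (a C b)) ⊖ (# (a C b) ⊕ # (a C suc b))
        ≈⟨ ≅-⊖ (≅-⊖ (≅-trans (≈⇒≅ (≈-reflexive (cong (λ n → B n (suc b * p)) (suc-[a*p+p′] a)))) (B-multiples (suc a) (suc b)))
                    (≅-zero last)) ≅-refl ⟩
      # (suc a C suc b) ⊖ 0# ⊖ (# (a C b) ⊕ # (a C suc b))
        ≈⟨ ≈⇒≅ (≈-trans (⊖-cong (⊖-cong (#C a b) ≈-refl) ≈-refl) (solve 1 (λ s → s :- :0 :- s := :0) ≈-refl _)) ⟩
      0# ∎)
      where
      n = a * p + p′
      open SetoidReasoning (≅-setoid 1)
      last : B n (p′ + b * p) ≅[ 1 ] # (a C b)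
      last = ≅-trans (≈⇒≅ (≈-reflexive (cong (B n) (ℕₚ.+-comm p′ (b * p)))))
        (≅-trans (B-lucas a b p′ ℕₚ.≤-refl) (≈⇒≅ (≈-trans (*-congˡ _ (qbin-diag q p′)) (*-identityʳ _))))
    B-lucas a b (suc k) k<p′ = ≅-difference (q-cancel (suc k) (begin
      y ⊗ (B n (b * p + suc k) ⊖ c ⊗ u (suc k))
        ≈⟨ ≈⇒≅ (*-congˡ y (⊖-cong (≈-reflexive (cong (B n) (ℕₚ.+-suc (b * p) k))) ≈-refl)) ⟩
      y ⊗ (B n (suc (b * p + k)) ⊖ c ⊗ u (suc k))
        ≈⟨ ≈⇒≅ (solve 6 (λ y s t c v w → y :* (t :- c :* w) := (s :+ y :* t) :- c :* (v :+ y :* w) :- (s :- c :* v)) ≈-refl y (B n (b * p + k)) _ c (u k) _) ⟩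
      (B n (b * p + k) ⊕ y ⊗ B n (suc (b * p + k))) ⊖ c ⊗ (u k ⊕ y ⊗ u (suc k)) ⊖ (B n (b * p + k) ⊖ c ⊗ u k)
        ≈⟨ ≅-⊖ (≅-⊖ (B-step a b k k<p′) (≅-*ˡ c (u-step k k<p′))) (≅-zero (B-lucas a b k (ℕₚ.<⇒≤ k<p′))) ⟩
      0# ⊖ c ⊗ 0# ⊖ 0#
        ≈⟨ ≈⇒≅ (solve 1 (λ c → :0 :- c :* :0 :- :0 := :0) ≈-refl c) ⟩
      0# ∎))
      where
      n = a * p + p′
      c = # (a C b)
      y = q ↑ suc k
      open SetoidReasoning (≅-setoid 1)

    -- After multiplication by `[k+1]` both sides are `Φ (a+1) C(a,b) u(k)` by absorption; the
    -- factor Φ makes q-Lucas modulo Φ sufficient on the left.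
    B-mod-Φ² : ∀ a b k → k < p′ → B (suc a * p) (b * p + suc k) ≅[ 2 ] # (suc a * (a C b)) ⊗ B p (suc k)
    B-mod-Φ² a b k k<p′ = ≅-difference (coprime-cancel (suc k) 1 (coprime k k<p′) difference≅0 (begin
      [ suc k ] ⊗ (E ⊖ c ⊗ B p (suc k))
        -- Absorption for `E` needs `[bp+k+1]` and not `[k+1]`. The two agree modulo Φ and `E` is a
        -- multiple of Φ, so the exchange is free modulo Φ².
        ≈⟨ ≈⇒≅ (solve 5 (λ s t e c v → s :* (e :- c :* v) := t :* e :- (t :- s) :* e :- c :* (s :* v)) ≈-refl [ suc k ] [ b * p + suc k ] E c (B p (suc k))) ⟩
      [ b * p + suc k ] ⊗ E ⊖ ([ b * p + suc k ] ⊖ [ suc k ]) ⊗ E ⊖ c ⊗ ([ suc k ] ⊗ B p (suc k))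
        ≈⟨ ≅-⊖ (≅-⊖ absorbed (≅-scale-0 1 1 (≅-zero ([n*p+k]≅ b (suc k))) E≅0))
                (≈⇒≅ (*-congˡ c (qbin-absorption q qint-cancel p′ k))) ⟩
      (Φ ⊗ (# suc a ⊗ # (a C b) ⊗ u k)) ⊖ 0# ⊖ c ⊗ (Φ ⊗ u k)
        ≈⟨ ≈⇒≅ (≈-trans (⊖-cong ≈-refl (*-congʳ _ (#-* (suc a) (a C b))))
              (solve 4 (λ Φ m c v → Φ :* (m :* c :* v) :- :0 :- m :* c :* (Φ :* v) := :0) ≈-refl Φ _ _ _)) ⟩
      0# ∎))
      where
      c = # (suc a * (a C b))
      E = B (suc a * p) (b * p + suc k)
      open SetoidReasoning (≅-setoid 2)
      E≅0 : E ≅[ 1 ] 0#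
      E≅0 = ≅-trans (≈⇒≅ (≈-reflexive (cong (B (suc a * p)) (ℕₚ.+-suc (b * p) k))))
        (B-coprime (suc a) (b * p + k) (coprime-mod′ b k k<p′))
      difference≅0 : E ⊖ c ⊗ B p (suc k) ≅[ 1 ] 0#
      difference≅0 = ≅-trans (≅-⊖ E≅0 (≅-*ˡ c (Bp≅0 k k<p′))) (≈⇒≅ (solve 1 (λ c → :0 :- c :* :0 := :0) ≈-refl c))
      absorbed : [ b * p + suc k ] ⊗ E ≅[ 2 ] Φ ⊗ (# suc a ⊗ # (a C b) ⊗ u k)
      absorbed = begin
        [ b * p + suc k ] ⊗ E
          ≈⟨ ≈⇒≅ (≈-reflexive (cong (λ m → [ m ] ⊗ B (suc a * p) m) (ℕₚ.+-suc (b * p) k))) ⟩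
        [ suc (b * p + k) ] ⊗ B (suc a * p) (suc (b * p + k))
          ≈⟨ ≈⇒≅ (B-absorb a (b * p + k)) ⟩
        [ suc a * p ] ⊗ B (a * p + p′) (b * p + k)
          ≈⟨ ≅-*ʳ _ ([n*p]≅ (suc a)) ⟩
        Φ ⊗ # suc a ⊗ B (a * p + p′) (b * p + k)
          ≈⟨ ≈⇒≅ (*-assoc _ _ _) ⟩
        Φ ⊗ (# suc a ⊗ B (a * p + p′) (b * p + k))
          ≈⟨ ≅-scale 1 1 Φ≅0 (≅-*ˡ _ (B-lucas a b k (ℕₚ.<⇒≤ k<p′))) ⟩
        Φ ⊗ (# suc a ⊗ (# (a C b) ⊗ u k))
          ≈⟨ ≈⇒≅ (*-congˡ Φ (*-assoc _ _ _)) ⟨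
        Φ ⊗ (# suc a ⊗ # (a C b) ⊗ u k) ∎

    -- The sum `S` modulo Φ³, up to the factor `2p`

    Q : ℕ → Carrier
    Q k = ∑ p (λ j → weight (# p) j ⊗ (q ↑ k) ↑ j)

    Q-identity : ∀ k → Coprime k p →
                 (1# ⊖ q ↑ k) ⊗ (1# ⊖ q ↑ k) ⊗ Q k ≅[ 1 ] # 2 ⊗ # p ⊗ q ↑ k
    Q-identity k k⊥p = begin
      (1# ⊖ x) ⊗ (1# ⊖ x) ⊗ Q k
        ≈⟨ ≈⇒≅ (solve 3 (λ x s S → (:1 :- x) :* (:1 :- x) :* S := ((:1 :- x) :* (:1 :- x) :* S :+ x :* (:1 :+ x) :* s) :- x :* (:1 :+ x) :* s) ≈-refl x (qint x p) (Q k)) ⟩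
      ((1# ⊖ x) ⊗ (1# ⊖ x) ⊗ Q k ⊕ x ⊗ (1# ⊕ x) ⊗ qint x p) ⊖ x ⊗ (1# ⊕ x) ⊗ qint x p
        ≈⟨ ≅-⊖ (≈⇒≅ (∑-weight-↑ N x p)) (≅-*ˡ _ (qint-q^k≅0 k k⊥p)) ⟩
      (N ⊗ x ⊕ x ↑ p ⊗ ((1# ⊖ x) ⊗ N ⊗ N ⊕ (# 2 ⊗ x ⊖ N ⊗ (1# ⊖ x)) ⊗ N ⊖ N ⊗ x)) ⊖ x ⊗ (1# ⊕ x) ⊗ 0#
        ≈⟨ ≅-⊖ (≅-+ˡ _ (≅-*ʳ _ (≅-trans (≈⇒≅ (^-assocʳ q k p)) (q^n*p≅1 k)))) ≅-refl ⟩
      (N ⊗ x ⊕ 1# ⊗ ((1# ⊖ x) ⊗ N ⊗ N ⊕ (# 2 ⊗ x ⊖ N ⊗ (1# ⊖ x)) ⊗ N ⊖ N ⊗ x)) ⊖ x ⊗ (1# ⊕ x) ⊗ 0#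
        ≈⟨ ≈⇒≅ (solve 2 (λ x N → (N :* x :+ :1 :* ((:1 :- x) :* N :* N :+ (:2 :* x :- N :* (:1 :- x)) :* N :- N :* x)) :- x :* (:1 :+ x) :* :0
             := :2 :* N :* x) ≈-refl x N) ⟩
      # 2 ⊗ N ⊗ x ∎
      where
      open SetoidReasoning (≅-setoid 1)
      x = q ↑ k
      N = # p

    -- Since `(q^(k+1))^j = (q^j)^(k+1)`, adding the missing term 1 completes the sum to
    -- `[p]_(q^j)`, a multiple of Φ.
    ∑-powers≅-1 : ∀ j → Coprime j p → ∑ p′ (λ k → (q ↑ suc k) ↑ j) ≅[ 1 ] 0# ⊖ 1#
    ∑-powers≅-1 j j⊥p = begin
      ∑ p′ (λ k → (q ↑ suc k) ↑ j)
        ≈⟨ ≈⇒≅ (∑-cong p′ (λ k _ → ≈-trans (^-assocʳ q (suc k) j)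
            (≈-trans (≈-reflexive (cong (q ↑_) (ℕₚ.*-comm (suc k) j))) (≈-sym (^-assocʳ q j (suc k)))))) ⟩
      ∑ p′ (λ k → (q ↑ j) ↑ suc k)
        ≈⟨ ≈⇒≅ (solve 1 (λ s → s := (:1 :+ s) :- :1) ≈-refl _) ⟩
      (1# ⊕ ∑ p′ (λ k → (q ↑ j) ↑ suc k)) ⊖ 1#
        ≈⟨ ≈⇒≅ (⊖-cong (≈-trans (≈-sym (∑-head p′ ((q ↑ j) ↑_))) (≈-sym (qint-∑ (q ↑ j) p))) ≈-refl) ⟩
      qint (q ↑ j) p ⊖ 1#
        ≈⟨ ≅-⊖ (qint-q^k≅0 j j⊥p) ≅-refl ⟩
      0# ⊖ 1# ∎
      where open SetoidReasoning (≅-setoid 1)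

    ∑Q≅ : ∑ p′ (λ k → Q (suc k)) ≅[ 1 ] 0# ⊖ ∑ p (weight (# p))
    ∑Q≅ = begin
      ∑ p′ (λ k → ∑ p (λ j → weight N j ⊗ (q ↑ suc k) ↑ j))
        ≈⟨ ≈⇒≅ (∑-swap p′ p _) ⟩
      ∑ p (λ j → ∑ p′ (λ k → weight N j ⊗ (q ↑ suc k) ↑ j))
        ≈⟨ ≈⇒≅ (∑-cong p (λ j _ → ∑-*ˡ p′ (weight N j) _)) ⟩
      ∑ p (λ j → weight N j ⊗ ∑ p′ (λ k → (q ↑ suc k) ↑ j))
        ≈⟨ ≅-∑ p inner ⟩
      ∑ p (λ j → (0# ⊖ 1#) ⊗ weight N j)
        ≈⟨ ≈⇒≅ (∑-*ˡ p (0# ⊖ 1#) (weight N)) ⟩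
      (0# ⊖ 1#) ⊗ ∑ p (weight N)
        ≈⟨ ≈⇒≅ (solve 1 (λ s → (:0 :- :1) :* s := :0 :- s) ≈-refl _) ⟩
      0# ⊖ ∑ p (weight N) ∎
      where
      open SetoidReasoning (≅-setoid 1)
      N = # p
      inner : ∀ j → j < p → weight N j ⊗ ∑ p′ (λ k → (q ↑ suc k) ↑ j) ≅[ 1 ] (0# ⊖ 1#) ⊗ weight N j
      -- For `j = 0` the power sum is `p - 1` and not -1, but its weight is 0.
      inner zero    _          = ≈⇒≅ (solve 2 (λ N s → :0 :* (N :- :0) :* s := (:0 :- :1) :* (:0 :* (N :- :0))) ≈-refl N _)
      inner (suc j) (s≤s j<p′) = ≅-trans (≅-*ˡ _ (∑-powers≅-1 (suc j) (coprime j j<p′))) (≈⇒≅ (*-comm _ _))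

    -- By `u-step`, `q^(k+1) u(k+1)` and `u(k)` differ by a sign modulo Φ, and squaring removes it:
    -- the difference of the squares contains the factor that `u-step` annihilates.
    u²-power : ∀ k → k ≤ p′ → q ↑ (k * suc k) ⊗ (u k ⊗ u k) ≅[ 1 ] 1#
    u²-power zero    _    = ≈⇒≅ (solve 0 (:1 :* (:1 :* :1) := :1) ≈-refl)
    u²-power (suc k) k<p′ = begin
      q ↑ (suc k * suc (suc k)) ⊗ (u (suc k) ⊗ u (suc k))
        ≈⟨ ≈⇒≅ (*-congʳ _ (≈-trans (≈-reflexive (cong (q ↑_) (exponent k))) (≈-trans (^-homo-* q (k * suc k) _) (*-congˡ _ (^-homo-* q (suc k) (suc k)))))) ⟩
      z ⊗ (y ⊗ y) ⊗ (u (suc k) ⊗ u (suc k))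
        ≈⟨ ≈⇒≅ (solve 4 (λ z y v w → z :* (y :* y) :* (w :* w) := z :* (v :* v) :+ z :* (y :* w :- v) :* (v :+ y :* w)) ≈-refl z y (u k) _) ⟩
      z ⊗ (u k ⊗ u k) ⊕ z ⊗ (y ⊗ u (suc k) ⊖ u k) ⊗ (u k ⊕ y ⊗ u (suc k))
        ≈⟨ ≅-+ (u²-power k (ℕₚ.<⇒≤ k<p′)) (≅-*ˡ _ (u-step k k<p′)) ⟩
      1# ⊕ z ⊗ (y ⊗ u (suc k) ⊖ u k) ⊗ 0#
        ≈⟨ ≈⇒≅ (≈-trans (+-congˡ 1# (zeroʳ _)) (+-identityʳ 1#)) ⟩
      1# ∎
      where
      open SetoidReasoning (≅-setoid 1)
      y = q ↑ suc k
      z = q ↑ (k * suc k)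
      exponent : ∀ k → suc k * suc (suc k) ≡ k * suc k + (suc k + suc k)
      exponent = solve-∀

    S : Carrier
    S = ∑ p′ (λ k → B p (suc k) ⊗ B p (suc k) ⊗ q ↑ (suc k * suc k))

    B²≅0 : ∀ k → k < p′ → B p (suc k) ⊗ B p (suc k) ≅[ 2 ] 0#
    B²≅0 k k<p′ = ≅-scale-0 1 1 (Bp≅0 k k<p′) (Bp≅0 k k<p′)

    δ : Carrier
    δ = q ↑ p ⊖ 1#

    δ≅0 : δ ≅[ 1 ] 0#
    δ≅0 = ≅-zero q^p≅1

    δ²≅0 : δ ⊗ δ ≅[ 2 ] 0#
    δ²≅0 = ≅-scale-0 1 1 δ≅0 δ≅0

    B-δ : ∀ k → (q ↑ suc k ⊖ 1#) ⊗ B p (suc k) ≈ δ ⊗ u k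
    B-δ k = begin
      (q ↑ suc k ⊖ 1#) ⊗ B p (suc k)            ≈⟨ *-congʳ _ (geometric q (suc k)) ⟨
      (q ⊖ 1#) ⊗ [ suc k ] ⊗ B p (suc k)        ≈⟨ *-assoc _ _ _ ⟩
      (q ⊖ 1#) ⊗ ([ suc k ] ⊗ B p (suc k))      ≈⟨ *-congˡ _ (qbin-absorption q qint-cancel p′ k) ⟩
      (q ⊖ 1#) ⊗ (Φ ⊗ u k)                      ≈⟨ *-assoc _ _ _ ⟨
      (q ⊖ 1#) ⊗ Φ ⊗ u k                        ≈⟨ *-congʳ _ (geometric q p) ⟩
      δ ⊗ u k                                   ∎
      where open SetoidReasoning setoid

    -- With `i = k + 1` the exponent splits as `i² = i + k i`: the part `q^i` is the numerator in
    -- `Q-identity`, the part `q^(k i)` normalises `u(k)²`. The former identity is lifted to Φ³ by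
    -- `B(p,i)²`, the latter by `δ²`.
    S-term : ∀ k → k < p′ →
             # 2 ⊗ # p ⊗ (B p (suc k) ⊗ B p (suc k) ⊗ q ↑ (suc k * suc k)) ≅[ 3 ] δ ⊗ δ ⊗ Q (suc k)
    S-term k k<p′ = begin
      # 2 ⊗ # p ⊗ (b ⊗ b ⊗ q ↑ (suc k * suc k))
        ≈⟨ ≈⇒≅ (*-congˡ _ (*-congˡ _ (^-homo-* q (suc k) (k * suc k)))) ⟩
      # 2 ⊗ # p ⊗ (b ⊗ b ⊗ (x ⊗ z))
        ≈⟨ ≈⇒≅ (solve 4 (λ N b x z → N :* (b :* b :* (x :* z)) := z :* (b :* b :* (N :* x))) ≈-refl _ b x z) ⟩
      z ⊗ (b ⊗ b ⊗ (# 2 ⊗ # p ⊗ x))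
        ≈⟨ ≅-*ˡ z (≅-scale 2 1 (B²≅0 k k<p′) (Q-identity (suc k) (coprime k k<p′))) ⟨
      z ⊗ (b ⊗ b ⊗ ((1# ⊖ x) ⊗ (1# ⊖ x) ⊗ Q (suc k)))
        ≈⟨ ≈⇒≅ (solve 4 (λ b x z s → z :* (b :* b :* ((:1 :- x) :* (:1 :- x) :* s)) := z :* (((x :- :1) :* b) :* ((x :- :1) :* b)) :* s) ≈-refl b x z _) ⟩
      z ⊗ (((x ⊖ 1#) ⊗ b) ⊗ ((x ⊖ 1#) ⊗ b)) ⊗ Q (suc k)
        ≈⟨ ≈⇒≅ (*-congʳ _ (*-congˡ z (*-cong (B-δ k) (B-δ k)))) ⟩
      z ⊗ ((δ ⊗ u k) ⊗ (δ ⊗ u k)) ⊗ Q (suc k)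
        ≈⟨ ≈⇒≅ (solve 4 (λ d v z s → z :* ((d :* v) :* (d :* v)) :* s := d :* d :* (z :* (v :* v) :* s)) ≈-refl δ (u k) z _) ⟩
      δ ⊗ δ ⊗ (z ⊗ (u k ⊗ u k) ⊗ Q (suc k))
        ≈⟨ ≅-scale 2 1 δ²≅0 (≅-*ʳ _ (u²-power k (ℕₚ.<⇒≤ k<p′))) ⟩
      δ ⊗ δ ⊗ (1# ⊗ Q (suc k))
        ≈⟨ ≈⇒≅ (*-congˡ _ (*-identityˡ _)) ⟩
      δ ⊗ δ ⊗ Q (suc k) ∎
      where
      open SetoidReasoning (≅-setoid 3)
      b = B p (suc k)
      x = q ↑ suc k
      z = q ↑ (k * suc k)

    2pS≅ : # 2 ⊗ # p ⊗ S ≅[ 3 ] 0# ⊖ δ ⊗ δ ⊗ ∑ p (weight (# p))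
    2pS≅ = begin
      # 2 ⊗ # p ⊗ S                               ≈⟨ ≈⇒≅ (∑-*ˡ p′ _ _) ⟨
      ∑ p′ (λ k → # 2 ⊗ # p ⊗ (B p (suc k) ⊗ B p (suc k) ⊗ q ↑ (suc k * suc k)))
                                                  ≈⟨ ≅-∑ p′ S-term ⟩
      ∑ p′ (λ k → δ ⊗ δ ⊗ Q (suc k))              ≈⟨ ≈⇒≅ (∑-*ˡ p′ _ _) ⟩
      δ ⊗ δ ⊗ ∑ p′ (λ k → Q (suc k))              ≈⟨ ≅-scale 2 1 δ²≅0 ∑Q≅ ⟩
      δ ⊗ δ ⊗ (0# ⊖ ∑ p (weight (# p)))           ≈⟨ ≈⇒≅ (solve 2 (λ d s → d :* (:0 :- s) := :0 :- d :* s) ≈-refl _ _) ⟩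
      0# ⊖ δ ⊗ δ ⊗ ∑ p (weight (# p))             ∎
      where open SetoidReasoning (≅-setoid 3)

    -- Division by `12p` and the congruence modulo Φ³

    module _ (m : ℕ) (p²≡12m+1 : p * p ≡ 12 * m + 1)
      (torsion-free : ∀ n f h → # suc n ⊗ f ≈ Φ ↑ 3 ⊗ h → Σ Carrier λ h′ → f ≈ Φ ↑ 3 ⊗ h′)
      where

      #-cancel : ∀ n {f} → # suc n ⊗ f ≅[ 3 ] 0# → f ≅[ 3 ] 0#
      #-cancel n {f} (h by e) = proj₁ t by ≈-trans (proj₂ t) (≈-sym (+-identityˡ _))
        where t = torsion-free n f h (≈-trans e (+-identityˡ _))

      #p²≈ : # p ⊗ # p ≈ # 12 ⊗ # m ⊕ 1#
      #p²≈ = ≈-trans (≈-sym (#-* p p)) (≈-trans (≈-reflexive (cong #_ p²≡12m+1))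
        (≈-trans (#-+ (12 * m) 1) (+-congʳ 1# (#-* 12 m))))

      -- With `W` the sum of the weights, `12 p S ≡ -6 W δ²`, and `6 W = p(p²-1) = 12 p m`.
      S≅ : S ≅[ 3 ] 0# ⊖ # m ⊗ (δ ⊗ δ)
      S≅ = ≅-difference (#-cancel (p′ + 11 * p) (begin
        # (12 * p) ⊗ (S ⊖ (0# ⊖ # m ⊗ (δ ⊗ δ)))
          ≈⟨ ≈⇒≅ (*-congʳ _ (#-* 12 p)) ⟩
        # 12 ⊗ # p ⊗ (S ⊖ (0# ⊖ # m ⊗ (δ ⊗ δ)))
          ≈⟨ ≈⇒≅ (solve 4 (λ N S m d → con (+ 12) :* N :* (S :- (:0 :- m :* d)) := con (+ 6) :* (:2 :* N :* S) :+ N :* ((con (+ 12) :* m :+ :1) :- :1) :* d) ≈-refl (# p) S (# m) (δ ⊗ δ)) ⟩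
        # 6 ⊗ (# 2 ⊗ # p ⊗ S) ⊕ # p ⊗ ((# 12 ⊗ # m ⊕ 1#) ⊖ 1#) ⊗ (δ ⊗ δ)
          ≈⟨ ≅-+ (≅-*ˡ (# 6) 2pS≅) (≈⇒≅ (*-congʳ _ (*-congˡ _ (⊖-cong (≈-sym #p²≈) ≈-refl)))) ⟩
        # 6 ⊗ (0# ⊖ δ ⊗ δ ⊗ W) ⊕ # p ⊗ (# p ⊗ # p ⊖ 1#) ⊗ (δ ⊗ δ)
          ≈⟨ ≈⇒≅ (solve 3 (λ W N d → con (+ 6) :* (:0 :- d :* W) :+ N :* (N :* N :- :1) :* d := d :* (N :* (N :* N :- :1) :- con (+ 6) :* W)) ≈-refl W (# p) (δ ⊗ δ)) ⟩
        δ ⊗ δ ⊗ (# p ⊗ (# p ⊗ # p ⊖ 1#) ⊖ # 6 ⊗ W)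
          ≈⟨ ≈⇒≅ (*-congˡ _ (⊖-cong ≈-refl (∑-weight (# p) p))) ⟩
        δ ⊗ δ ⊗ (# p ⊗ (# p ⊗ # p ⊖ 1#) ⊖ (# 3 ⊗ # p ⊗ # p ⊗ (# p ⊖ 1#) ⊖ (# p ⊖ 1#) ⊗ # p ⊗ (# 2 ⊗ # p ⊖ 1#)))
          ≈⟨ ≈⇒≅ (solve 2 (λ N d → d :* (N :* (N :* N :- :1) :- (con (+ 3) :* N :* N :* (N :- :1) :- (N :- :1) :* N :* (:2 :* N :- :1))) := :0) ≈-refl (# p) (δ ⊗ δ)) ⟩
        0# ∎))
        where
        open SetoidReasoning (≅-setoid 3)
        W = ∑ p (weight (# p))

      S≅0 : S ≅[ 2 ] 0#
      S≅0 = ≅-trans (≅-∑ p′ (λ k k<p′ → ≅-trans (≅-*ʳ _ (B²≅0 k k<p′)) (≈⇒≅ (zeroˡ _)))) (≈⇒≅ (∑-0 p′))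

      -- Absorption rewrites the factor in terms of the upper index `a` itself; this form also
      -- covers `a = 0`, where both sides vanish.
      B-mod-Φ²′ : ∀ a b k → k < p′ → B (a * p) (b * p + suc k) ≅[ 2 ] # (suc b * (a C suc b)) ⊗ B p (suc k)
      B-mod-Φ²′ zero b k k<p′ = ≈⇒≅ (≈-trans (≈-reflexive (cong (B 0) (ℕₚ.+-suc (b * p) k)))
        (≈-sym (≈-trans (*-congʳ _ (≈-reflexive (cong #_ (ℕₚ.*-zeroʳ (suc b))))) (zeroˡ _))))
      B-mod-Φ²′ (suc a) b k k<p′ = subst (λ c → B (suc a * p) (b * p + suc k) ≅[ 2 ] # c ⊗ B p (suc k))
        (C-absorption a b) (B-mod-Φ² a b k k<p′)

      -- The first factor `B(p,i)` lifts the congruence modulo Φ² for the second binomial to Φ³.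
      -- Then `B(p,i)²` is in front, and `q^(p i b) ≡ 1` modulo Φ suffices.
      middle≅ : ∀ a b → ∑ p′ (middle a b) ≅[ 3 ] # (suc b * (a C suc b)) ⊗ S
      middle≅ a b = ≅-trans (≅-∑ p′ term) (≈⇒≅ (∑-*ˡ p′ c _))
        where
        open SetoidReasoning (≅-setoid 3)
        c = # (suc b * (a C suc b))
        term : ∀ k → k < p′ → middle a b k ≅[ 3 ] c ⊗ (B p (suc k) ⊗ B p (suc k) ⊗ q ↑ (suc k * suc k))
        term k k<p′ = begin
          β ⊗ (q ↑ (i * (b * p + i)) ⊗ B (a * p) (b * p + i))
            ≈⟨ ≅-scale 1 2 (Bp≅0 k k<p′) (≅-*ˡ _ (B-mod-Φ²′ a b k k<p′)) ⟩
          β ⊗ (q ↑ (i * (b * p + i)) ⊗ (c ⊗ β))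
            ≈⟨ ≈⇒≅ (*-congˡ β (*-congʳ _ (≈-trans (≈-reflexive (cong (q ↑_) (exponent i b p))) (^-homo-* q (p * (i * b)) (i * i))))) ⟩
          β ⊗ ((q ↑ (p * (i * b)) ⊗ q ↑ (i * i)) ⊗ (c ⊗ β))
            ≈⟨ ≈⇒≅ (solve 4 (λ β y z c → β :* ((y :* z) :* (c :* β)) := c :* (β :* β :* (y :* z))) ≈-refl β _ _ c) ⟩
          c ⊗ (β ⊗ β ⊗ (q ↑ (p * (i * b)) ⊗ q ↑ (i * i)))
            ≈⟨ ≅-*ˡ c (≅-scale 2 1 (B²≅0 k k<p′) (≅-trans (≅-*ʳ _ (q^p*n≅1 (i * b))) (≈⇒≅ (*-identityˡ _)))) ⟩
          c ⊗ (β ⊗ β ⊗ q ↑ (i * i)) ∎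
          where
          i = suc k
          β = B p i
          exponent : ∀ i b p → i * (b * p + i) ≡ p * (i * b) + i * i
          exponent = solve-∀

      X : Carrier
      X = q ↑ (p * p)

      B-mod-Φ³ : ∀ a b → B (a * p) (b * p) ≅[ 3 ] qbin X a b ⊕ # multiplicity a b ⊗ S
      B-mod-Φ³ a zero = ≈⇒≅ (≈-sym (≈-trans (+-congˡ 1# (≈-trans (*-congʳ S (≈-reflexive (cong #_ (ℕₚ.*-zeroʳ (a C 1))))) (zeroˡ S))) (+-identityʳ 1#)))
      B-mod-Φ³ zero (suc b) = ≈⇒≅ (≈-sym (≈-trans (+-identityˡ _) (zeroˡ S)))
      B-mod-Φ³ (suc a) (suc b) = begin
        B (suc a * p) (suc b * p)
          ≈⟨ ≈⇒≅ (B-vandermonde a b) ⟩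
        B (a * p) (b * p) ⊕ ∑ p′ (middle a b) ⊕ q ↑ (p * (suc b * p)) ⊗ B (a * p) (suc b * p)
          ≈⟨ ≅-+ (≅-+ (B-mod-Φ³ a b) (middle≅ a b)) (≅-* (≈⇒≅ power) (B-mod-Φ³ a (suc b))) ⟩
        (qbin X a b ⊕ # multiplicity a b ⊗ S) ⊕ # (suc b * (a C suc b)) ⊗ S ⊕ X ↑ suc b ⊗ (qbin X a (suc b) ⊕ # multiplicity a (suc b) ⊗ S)
          ≈⟨ ≈⇒≅ (solve 7 (λ r m n s x r′ m′ → (r :+ m :* s) :+ n :* s :+ x :* (r′ :+ m′ :* s) := (r :+ x :* r′) :+ ((m :+ n) :* s :+ m′ :* (s :* x))) ≈-refl _ _ _ S _ _ _) ⟩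
        qbin X (suc a) (suc b) ⊕ ((# multiplicity a b ⊕ # (suc b * (a C suc b))) ⊗ S ⊕ # multiplicity a (suc b) ⊗ (S ⊗ X ↑ suc b))
          -- `X^(b+1)` is 1 only modulo Φ, which is enough in front of `S`, a multiple of Φ².
          ≈⟨ ≅-+ˡ _ (≅-+ˡ _ (≅-*ˡ _ (≅-scale 2 1 S≅0 (≅-trans (≈⇒≅ (^-assocʳ q (p * p) (suc b))) (subst (λ n → q ↑ n ≅[ 1 ] 1#) (sym (ℕₚ.*-assoc p p (suc b))) (q^p*n≅1 (p * suc b))))))) ⟩
        qbin X (suc a) (suc b) ⊕ ((# multiplicity a b ⊕ # (suc b * (a C suc b))) ⊗ S ⊕ # multiplicity a (suc b) ⊗ (S ⊗ 1#))
          ≈⟨ ≈⇒≅ (+-congˡ _ (solve 4 (λ m n s m′ → (m :+ n) :* s :+ m′ :* (s :* :1) := (m :+ m′ :+ n) :* s) ≈-refl _ _ S _)) ⟩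
        qbin X (suc a) (suc b) ⊕ (# multiplicity a b ⊕ # multiplicity a (suc b) ⊕ # (suc b * (a C suc b))) ⊗ S
          ≈⟨ ≈⇒≅ (+-congˡ _ (*-congʳ S (≈-trans (≈-reflexive (cong #_ (multiplicity-step a b)))
               (≈-trans (#-+ (multiplicity a b + multiplicity a (suc b)) _) (+-congʳ _ (#-+ (multiplicity a b) _)))))) ⟨
        qbin X (suc a) (suc b) ⊕ # multiplicity (suc a) (suc b) ⊗ S ∎
        where
        open SetoidReasoning (≅-setoid 3)
        -- The term `i = p` has the exponent `p(bp+p) = p²(b+1)`; this is where the base `q^(p²)`
        -- comes from.
        power : q ↑ (p * (suc b * p)) ≈ X ↑ suc b
        power = ≈-trans (≈-reflexive (cong (q ↑_) (trans (cong (p *_) (ℕₚ.*-comm (suc b) p)) (sym (ℕₚ.*-assoc p p (suc b))))))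
                        (≈-sym (^-assocʳ q (p * p) (suc b)))

      qbin-ljunggren : ∀ a b → B (a * p) (b * p) ≅[ 3 ] qbin X a b ⊖ # (multiplicity a b * m) ⊗ (δ ⊗ δ)
      qbin-ljunggren a b = begin
        B (a * p) (b * p)
          ≈⟨ B-mod-Φ³ a b ⟩
        qbin X a b ⊕ # multiplicity a b ⊗ S
          ≈⟨ ≅-+ˡ _ (≅-*ˡ _ S≅) ⟩
        qbin X a b ⊕ # multiplicity a b ⊗ (0# ⊖ # m ⊗ (δ ⊗ δ))
          ≈⟨ ≈⇒≅ (solve 4 (λ r n m d → r :+ n :* (:0 :- m :* d) := r :- (n :* m) :* d) ≈-refl _ _ _ _) ⟩
        qbin X a b ⊖ (# multiplicity a b ⊗ # m) ⊗ (δ ⊗ δ)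
          ≈⟨ ≈⇒≅ (⊖-cong ≈-refl (*-congʳ _ (#-* (multiplicity a b) m))) ⟨
        qbin X a b ⊖ # (multiplicity a b * m) ⊗ (δ ⊗ δ) ∎
        where open SetoidReasoning (≅-setoid 3)

      -- The powers are written in the form to which `_^ₚ_` reduces at the exponents 2 and 3, and
      -- each ingredient may be replaced by an equal one, so that the result fits the polynomials of
      -- the theorem.
      qbin-ljunggren-Σ : ∀ a b {f g c d φ} →
        f ≈ B (a * p) (b * p) → g ≈ qbin X a b → c ≈ # (multiplicity a b * m) → d ≈ δ → φ ≈ Φ →
        Σ Carrier λ h → f ⊖ (g ⊖ c ⊗ (d ⊗ (d ⊗ 1#))) ≈ φ ⊗ (φ ⊗ (φ ⊗ 1#)) ⊗ h
      qbin-ljunggren-Σ a b {f} {g} {c} {d} {φ} ef eg ec ed eφ = h , (begin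
        f ⊖ (g ⊖ c ⊗ (d ⊗ (d ⊗ 1#)))
          ≈⟨ ⊖-cong (≈-trans ef (equality t)) (⊖-cong eg (*-cong ec (*-cong ed (≈-trans (*-identityʳ d) ed)))) ⟩
        (r ⊕ Φ ↑ 3 ⊗ h) ⊖ r
          ≈⟨ solve 2 (λ r s → (r :+ s) :- r := s) ≈-refl r _ ⟩
        Φ ↑ 3 ⊗ h
          ≈⟨ *-congʳ h (^-congˡ 3 eφ) ⟨
        φ ↑ 3 ⊗ h ∎)
        where
        open SetoidReasoning setoid
        t = qbin-ljunggren a b
        h = quotient t
        r = qbin X a b ⊖ # (multiplicity a b * m) ⊗ (δ ⊗ δ)

-- The ring ℤ[q]

-- A record around _≈ₚ_, so that both sides can be inferred by unification.
infix 4 _≋_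
record _≋_ (f g : Poly) : Set where
  constructor coeffwise
  field at : f ≈ₚ g
open _≋_ public

≋-refl : ∀ {f} → f ≋ f
≋-refl = coeffwise λ _ → refl

≋-sym : ∀ {f g} → f ≋ g → g ≋ f
≋-sym e = coeffwise λ n → sym (at e n)

≋-trans : ∀ {f g h} → f ≋ g → g ≋ h → f ≋ h
≋-trans d e = coeffwise λ n → trans (at d n) (at e n)

≋-reflexive : ∀ {f g} → f ≡ g → f ≋ g
≋-reflexive refl = ≋-refl

+ℤ-congˡ : ∀ a {x y} → x ≡ y → a ℤ.+ x ≡ a ℤ.+ y
+ℤ-congˡ a = cong (λ z → a ℤ.+ z)

coeff-+ : ∀ f g n → coeff (f +ₚ g) n ≡ coeff f n ℤ.+ coeff g n
coeff-+ []      g       n       = sym (ℤₚ.+-identityˡ _)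
coeff-+ (a ∷ f) []      n       = sym (ℤₚ.+-identityʳ _)
coeff-+ (a ∷ f) (b ∷ g) zero    = refl
coeff-+ (a ∷ f) (b ∷ g) (suc n) = coeff-+ f g n

coeff-scale : ∀ c f n → coeff (scale c f) n ≡ c ℤ.* coeff f n
coeff-scale c []      n       = sym (ℤₚ.*-zeroʳ c)
coeff-scale c (a ∷ f) zero    = refl
coeff-scale c (a ∷ f) (suc n) = coeff-scale c f n

-- The Cauchy product of coefficient sequences. The ring laws are proved for sequences because lists
-- that differ by trailing zeros represent the same polynomial.
conv : (ℕ → ℤ) → (ℕ → ℤ) → ℕ → ℤ
conv F G zero    = F 0 ℤ.* G 0
conv F G (suc n) = F 0 ℤ.* G (suc n) ℤ.+ conv (F ∘ suc) G n

conv-cong : ∀ {F F′ G G′} → (∀ n → F n ≡ F′ n) → (∀ n → G n ≡ G′ n) → ∀ n → conv F G n ≡ conv F′ G′ n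
conv-cong p r zero    = cong₂ ℤ._*_ (p 0) (r 0)
conv-cong p r (suc n) = cong₂ ℤ._+_ (cong₂ ℤ._*_ (p 0) (r (suc n))) (conv-cong (p ∘ suc) r n)

conv-zeroˡ : ∀ G n → conv (λ _ → + 0) G n ≡ + 0
conv-zeroˡ G zero    = ℤₚ.*-zeroˡ (G 0)
conv-zeroˡ G (suc n) = cong₂ ℤ._+_ (ℤₚ.*-zeroˡ (G (suc n))) (conv-zeroˡ G n)

conv-distribʳ : ∀ F G H n → conv (λ i → F i ℤ.+ G i) H n ≡ conv F H n ℤ.+ conv G H n
conv-distribʳ F G H zero    = ℤₚ.*-distribʳ-+ (H 0) (F 0) (G 0)
conv-distribʳ F G H (suc n) =
  trans (+ℤ-congˡ ((F 0 ℤ.+ G 0) ℤ.* H (suc n)) (conv-distribʳ (F ∘ suc) (G ∘ suc) H n))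
        (lemma (F 0) (G 0) (H (suc n)) _ _)
  where
  lemma : ∀ a b h x y → (a ℤ.+ b) ℤ.* h ℤ.+ (x ℤ.+ y) ≡ (a ℤ.* h ℤ.+ x) ℤ.+ (b ℤ.* h ℤ.+ y)
  lemma = ℤ-Solver.solve-∀

conv-scaleˡ : ∀ c F G n → conv (λ i → c ℤ.* F i) G n ≡ c ℤ.* conv F G n
conv-scaleˡ c F G zero    = ℤₚ.*-assoc c (F 0) (G 0)
conv-scaleˡ c F G (suc n) =
  trans (+ℤ-congˡ (c ℤ.* F 0 ℤ.* G (suc n)) (conv-scaleˡ c (F ∘ suc) G n))
        (lemma c (F 0) (G (suc n)) _)
  where
  lemma : ∀ c a h x → c ℤ.* a ℤ.* h ℤ.+ c ℤ.* x ≡ c ℤ.* (a ℤ.* h ℤ.+ x)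
  lemma = ℤ-Solver.solve-∀

-- The recursion of `conv` consumes its first argument; this is the mirrored recursion, from which
-- commutativity follows.
conv-sucʳ : ∀ F G n → conv F G (suc n) ≡ F (suc n) ℤ.* G 0 ℤ.+ conv F (G ∘ suc) n
conv-sucʳ F G zero    = ℤₚ.+-comm (F 0 ℤ.* G 1) (F 1 ℤ.* G 0)
conv-sucʳ F G (suc n) =
  trans (+ℤ-congˡ (F 0 ℤ.* G (suc (suc n))) (conv-sucʳ (F ∘ suc) G n))
        (lemma (F 0 ℤ.* G (suc (suc n))) (F (suc (suc n)) ℤ.* G 0) _)
  where
  lemma : ∀ x y z → x ℤ.+ (y ℤ.+ z) ≡ y ℤ.+ (x ℤ.+ z)
  lemma = ℤ-Solver.solve-∀

conv-comm : ∀ F G n → conv F G n ≡ conv G F n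
conv-comm F G zero    = ℤₚ.*-comm (F 0) (G 0)
conv-comm F G (suc n) =
  trans (cong₂ ℤ._+_ (ℤₚ.*-comm (F 0) (G (suc n))) (conv-comm (F ∘ suc) G n))
        (sym (conv-sucʳ G F n))

conv-assoc : ∀ F G H n → conv (conv F G) H n ≡ conv F (conv G H) n
conv-assoc F G H zero    = ℤₚ.*-assoc (F 0) (G 0) (H 0)
conv-assoc F G H (suc n) = begin
  F 0 ℤ.* G 0 ℤ.* H (suc n) ℤ.+ conv (conv F G ∘ suc) H n
    ≡⟨ +ℤ-congˡ (F 0 ℤ.* G 0 ℤ.* H (suc n))
         (trans (conv-distribʳ (λ i → F 0 ℤ.* G (suc i)) (conv (F ∘ suc) G) H n)
                (cong₂ ℤ._+_ (conv-scaleˡ (F 0) (G ∘ suc) H n) (conv-assoc (F ∘ suc) G H n))) ⟩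
  F 0 ℤ.* G 0 ℤ.* H (suc n) ℤ.+ (F 0 ℤ.* conv (G ∘ suc) H n ℤ.+ conv (F ∘ suc) (conv G H) n)
    ≡⟨ lemma (F 0) (G 0) (H (suc n)) _ _ ⟩
  F 0 ℤ.* (G 0 ℤ.* H (suc n) ℤ.+ conv (G ∘ suc) H n) ℤ.+ conv (F ∘ suc) (conv G H) n ∎
  where
  open ≡.≡-Reasoning
  lemma : ∀ a b h x y → a ℤ.* b ℤ.* h ℤ.+ (a ℤ.* x ℤ.+ y) ≡ a ℤ.* (b ℤ.* h ℤ.+ x) ℤ.+ y
  lemma = ℤ-Solver.solve-∀

coeff-* : ∀ f g n → coeff (f *ₚ g) n ≡ conv (coeff f) (coeff g) n
coeff-* []      g n       = sym (conv-zeroˡ (coeff g) n)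
coeff-* (a ∷ f) g zero    =
  trans (coeff-+ (scale a g) _ 0)
        (trans (ℤₚ.+-identityʳ _) (coeff-scale a g 0))
coeff-* (a ∷ f) g (suc n) =
  trans (coeff-+ (scale a g) _ (suc n)) (cong₂ ℤ._+_ (coeff-scale a g (suc n)) (coeff-* f g n))

+-cong : ∀ {f f′ g g′} → f ≋ f′ → g ≋ g′ → f +ₚ g ≋ f′ +ₚ g′
+-cong {f} {f′} {g} {g′} d e = coeffwise λ n →
  trans (coeff-+ f g n) (trans (cong₂ ℤ._+_ (at d n) (at e n)) (sym (coeff-+ f′ g′ n)))

*-cong : ∀ {f f′ g g′} → f ≋ f′ → g ≋ g′ → f *ₚ g ≋ f′ *ₚ g′
*-cong {f} {f′} {g} {g′} d e = coeffwise λ n →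
  trans (coeff-* f g n) (trans (conv-cong (at d) (at e) n) (sym (coeff-* f′ g′ n)))

coeff-neg : ∀ f n → coeff (negₚ f) n ≡ ℤ.- coeff f n
coeff-neg f n = trans (coeff-scale _ f n) (ℤₚ.-1*i≡-i _)

neg-cong : ∀ {f g} → f ≋ g → negₚ f ≋ negₚ g
neg-cong {f} {g} e = coeffwise λ n →
  trans (coeff-neg f n) (trans (cong ℤ.-_ (at e n)) (sym (coeff-neg g n)))

+-assoc : ∀ f g h → (f +ₚ g) +ₚ h ≋ f +ₚ (g +ₚ h)
+-assoc f g h = coeffwise λ n → begin
  coeff ((f +ₚ g) +ₚ h) n                   ≡⟨ coeff-+ (f +ₚ g) h n ⟩
  coeff (f +ₚ g) n ℤ.+ coeff h n            ≡⟨ cong (ℤ._+ coeff h n) (coeff-+ f g n) ⟩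
  coeff f n ℤ.+ coeff g n ℤ.+ coeff h n     ≡⟨ ℤₚ.+-assoc (coeff f n) (coeff g n) (coeff h n) ⟩
  coeff f n ℤ.+ (coeff g n ℤ.+ coeff h n)   ≡⟨ +ℤ-congˡ (coeff f n) (coeff-+ g h n) ⟨
  coeff f n ℤ.+ coeff (g +ₚ h) n            ≡⟨ coeff-+ f (g +ₚ h) n ⟨
  coeff (f +ₚ (g +ₚ h)) n                   ∎
  where open ≡.≡-Reasoning

+-comm : ∀ f g → f +ₚ g ≋ g +ₚ f
+-comm f g = coeffwise λ n →
  trans (coeff-+ f g n) (trans (ℤₚ.+-comm (coeff f n) (coeff g n)) (sym (coeff-+ g f n)))

+-identityʳ : ∀ f → f +ₚ 0ₚ ≋ f
+-identityʳ f = coeffwise λ n → trans (coeff-+ f 0ₚ n) (ℤₚ.+-identityʳ _)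

+-inverseʳ : ∀ f → f +ₚ negₚ f ≋ 0ₚ
+-inverseʳ f = coeffwise λ n →
  trans (coeff-+ f (negₚ f) n)
        (trans (cong (λ z → coeff f n ℤ.+ z) (coeff-neg f n)) (ℤₚ.+-inverseʳ (coeff f n)))

*-comm : ∀ f g → f *ₚ g ≋ g *ₚ f
*-comm f g = coeffwise λ n →
  trans (coeff-* f g n) (trans (conv-comm (coeff f) (coeff g) n) (sym (coeff-* g f n)))

*-assoc : ∀ f g h → (f *ₚ g) *ₚ h ≋ f *ₚ (g *ₚ h)
*-assoc f g h = coeffwise λ n → begin
  coeff ((f *ₚ g) *ₚ h) n                          ≡⟨ coeff-* (f *ₚ g) h n ⟩
  conv (coeff (f *ₚ g)) (coeff h) n                ≡⟨ conv-cong (coeff-* f g) (λ _ → refl) n ⟩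
  conv (conv (coeff f) (coeff g)) (coeff h) n      ≡⟨ conv-assoc (coeff f) (coeff g) (coeff h) n ⟩
  conv (coeff f) (conv (coeff g) (coeff h)) n      ≡⟨ conv-cong (λ _ → refl) (coeff-* g h) n ⟨
  conv (coeff f) (coeff (g *ₚ h)) n                ≡⟨ coeff-* f (g *ₚ h) n ⟨
  coeff (f *ₚ (g *ₚ h)) n                          ∎
  where open ≡.≡-Reasoning

*-distribʳ-+ : ∀ h f g → (f +ₚ g) *ₚ h ≋ (f *ₚ h) +ₚ (g *ₚ h)
*-distribʳ-+ h f g = coeffwise λ n → begin
  coeff ((f +ₚ g) *ₚ h) n                                        ≡⟨ coeff-* (f +ₚ g) h n ⟩
  conv (coeff (f +ₚ g)) (coeff h) n                              ≡⟨ conv-cong (coeff-+ f g) (λ _ → refl) n ⟩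
  conv (λ i → coeff f i ℤ.+ coeff g i) (coeff h) n               ≡⟨ conv-distribʳ (coeff f) (coeff g) (coeff h) n ⟩
  conv (coeff f) (coeff h) n ℤ.+ conv (coeff g) (coeff h) n      ≡⟨ cong₂ ℤ._+_ (coeff-* f h n) (coeff-* g h n) ⟨
  coeff (f *ₚ h) n ℤ.+ coeff (g *ₚ h) n                          ≡⟨ coeff-+ (f *ₚ h) (g *ₚ h) n ⟨
  coeff ((f *ₚ h) +ₚ (g *ₚ h)) n                                 ∎
  where open ≡.≡-Reasoning

*-identityˡ : ∀ f → 1ₚ *ₚ f ≋ f
*-identityˡ f = coeffwise λ where
  zero    → trans (coeff-* 1ₚ f 0) (ℤₚ.*-identityˡ _)
  (suc n) → trans (coeff-* 1ₚ f (suc n))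
              (trans (cong₂ ℤ._+_ (ℤₚ.*-identityˡ (coeff f (suc n))) (conv-zeroˡ (coeff f) n)) (ℤₚ.+-identityʳ _))

polyRing : CommutativeRing 0ℓ 0ℓ
polyRing = record
  { Carrier = Poly ; _≈_ = _≋_ ; _+_ = _+ₚ_ ; _*_ = _*ₚ_ ; -_ = negₚ ; 0# = 0ₚ ; 1# = 1ₚ
  ; isCommutativeRing = record
    { isRing = record
      { +-isAbelianGroup = record
        { isGroup = record
          { isMonoid = record
            { isSemigroup = record
              { isMagma = record
                { isEquivalence = record { refl = ≋-refl ; sym = ≋-sym ; trans = ≋-trans }
                ; ∙-cong = +-cong }
              ; assoc = +-assoc }
            ; identity = (λ _ → ≋-refl) , +-identityʳ }
          ; inverse = (λ f → ≋-trans (+-comm (negₚ f) f) (+-inverseʳ f)) , +-inverseʳ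
          ; ⁻¹-cong = neg-cong }
        ; comm = +-comm }
      ; *-cong = *-cong
      ; *-assoc = *-assoc
      ; *-identity = *-identityˡ , λ f → ≋-trans (*-comm f 1ₚ) (*-identityˡ f)
      ; distrib = (λ h f g → ≋-trans (*-comm h (f +ₚ g))
                    (≋-trans (*-distribʳ-+ h f g) (+-cong (*-comm f h) (*-comm g h)))) , *-distribʳ-+ }
    ; *-comm = *-comm } }

-- Constants, divisibility and cancellation in ℤ[q]

const-* : ∀ a b → const (a ℤ.* b) ≋ const a *ₚ const b
const-* a b = coeffwise λ where
  zero    → sym (ℤₚ.+-identityʳ _)
  (suc n) → refl

const-hom : ℤ-rawRing -Raw-AlmostCommutative⟶ fromCommutativeRing polyRing
const-hom = record
  { ⟦_⟧ = const
  ; +-homo = λ _ _ → ≋-refl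
  ; *-homo = const-*
  ; -‿homo = λ a → ≋-reflexive (cong const (sym (ℤₚ.-1*i≡-i a)))
  ; 0-homo = coeffwise λ { zero → refl ; (suc n) → refl }
  ; 1-homo = ≋-refl }

-- As `m` starts with 1, the lowest coefficient of `h m` is that of `h`. Once `c` divides it, the
-- corresponding multiple of `m` can be subtracted, and the tail of `h` satisfies the same
-- hypothesis.
∣-coeffs : ∀ c m → coeff m 0 ≡ + 1 → ∀ h → (∀ n → c ∣ℤ coeff (h *ₚ m) n) → ∀ n → c ∣ℤ coeff h n
∣-coeffs c m m₀ []      c∣hm n = dividesℤ (+ 0) refl
∣-coeffs c m m₀ (a ∷ h) c∣hm = λ { zero → c∣a ; (suc n) → ∣-coeffs c m m₀ h c∣tail n }
  where
  c∣a : c ∣ℤ a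
  c∣a = subst (c ∣ℤ_)
    (trans (coeff-+ (scale a m) _ 0) (trans (ℤₚ.+-identityʳ _)
      (trans (coeff-scale a m 0) (trans (cong (a ℤ.*_) m₀) (ℤₚ.*-identityʳ a)))))
    (c∣hm 0)
  c∣tail : ∀ n → c ∣ℤ coeff (h *ₚ m) n
  c∣tail n = ℤ∣.∣m+n∣m⇒∣n
    (subst (c ∣ℤ_) (coeff-+ (scale a m) (+ 0 ∷ (h *ₚ m)) (suc n)) (c∣hm (suc n)))
    (subst (c ∣ℤ_) (sym (coeff-scale a m (suc n))) (ℤ∣.∣m⇒∣m*n (coeff m (suc n)) c∣a))

coeff-const-* : ∀ c f n → coeff (const c *ₚ f) n ≡ c ℤ.* coeff f n
coeff-const-* c f zero    = coeff-* (const c) f 0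
coeff-const-* c f (suc n) = trans (coeff-* (const c) f (suc n))
  (trans (+ℤ-congˡ (c ℤ.* coeff f (suc n)) (conv-zeroˡ (coeff f) n)) (ℤₚ.+-identityʳ _))

divideₚ : ∀ c h → (∀ n → c ∣ℤ coeff h n) → Σ Poly λ h′ → h ≋ const c *ₚ h′
divideₚ c [] c∣h = 0ₚ , *-comm 0ₚ (const c)
divideₚ c (a ∷ h) c∣h with c∣h 0 | divideₚ c h (λ n → c∣h (suc n))
... | dividesℤ k a≡kc | h′ , h≋ = k ∷ h′ , coeffwise λ where
  zero    → trans a≡kc (trans (ℤₚ.*-comm k c) (sym (coeff-const-* c (k ∷ h′) 0)))
  (suc n) → trans (at h≋ n) (trans (coeff-const-* c h′ n) (sym (coeff-const-* c (k ∷ h′) (suc n))))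

-- The case `c = 0` of `∣-coeffs`, since a multiple of 0 is 0.
*-zero-cancelˡ : ∀ m → coeff m 0 ≡ + 1 → ∀ f → m *ₚ f ≋ 0ₚ → f ≋ 0ₚ
*-zero-cancelˡ m m₀ f mf≋0 = coeffwise λ n → ℤ∣.0∣⇒≡0
  (∣-coeffs (+ 0) m m₀ f (λ n → dividesℤ (+ 0) (trans (at (*-comm f m) n) (at mf≋0 n))) n)

coeff-*-0 : ∀ f g → coeff f 0 ≡ + 1 → coeff g 0 ≡ + 1 → coeff (f *ₚ g) 0 ≡ + 1
coeff-*-0 f g f₀ g₀ = trans (coeff-* f g 0) (cong₂ ℤ._*_ f₀ g₀)

coeff-^-0 : ∀ f n → coeff f 0 ≡ + 1 → coeff (f ^ₚ n) 0 ≡ + 1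
coeff-^-0 f zero    f₀ = refl
coeff-^-0 f (suc n) f₀ = coeff-*-0 f (f ^ₚ n) f₀ (coeff-^-0 f n f₀)

const-cancelˡ : ∀ c → c ≢ + 0 → ∀ {f g} → const c *ₚ f ≋ const c *ₚ g → f ≋ g
const-cancelˡ c c≢0 {f} {g} e = coeffwise λ n →
  ℤₚ.*-cancelˡ-≡ c (coeff f n) (coeff g n) {{ℤ.≢-nonZero c≢0}} (trans (sym (coeff-const-* c f n)) (trans (at e n) (coeff-const-* c g n)))

-- From `c f = m h` the constant `c` divides all coefficients of `h m`, hence those of `h` by
-- `∣-coeffs`; then `c` cancels from the equation.
const-cancel-multiple : ∀ c m → c ≢ + 0 → coeff m 0 ≡ + 1 → ∀ f h →
                        const c *ₚ f ≋ m *ₚ h → Σ Poly λ h′ → f ≋ m *ₚ h′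
const-cancel-multiple c m c≢0 m₀ f h cf≋mh = h′ , const-cancelˡ c c≢0
  (≋-trans cf≋mh (≋-trans (*-cong {m} ≋-refl h≋ch′) (≋-trans (≋-sym (*-assoc m (const c) h′))
    (≋-trans (*-cong {m *ₚ const c} {_} {h′} (*-comm m (const c)) ≋-refl) (*-assoc (const c) m h′)))))
  where
  c∣hm : ∀ n → c ∣ℤ coeff (h *ₚ m) n
  c∣hm n = dividesℤ (coeff f n)
    (trans (at (*-comm h m) n) (trans (sym (at cf≋mh n)) (trans (coeff-const-* c f n) (ℤₚ.*-comm c _))))
  h′ = proj₁ (divideₚ c h (∣-coeffs c m m₀ h c∣hm))
  h≋ch′ = proj₂ (divideₚ c h (∣-coeffs c m m₀ h c∣hm))

coeff-qnum-0 : ∀ x n → coeff x 0 ≡ + 0 → coeff (qnum x (suc n)) 0 ≡ + 1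
coeff-qnum-0 x n x₀ = trans (coeff-+ 1ₚ (x *ₚ qnum x n) 0)
  (cong (ℤ._+_ (+ 1)) (trans (coeff-* x (qnum x n) 0) (trans (cong (ℤ._* coeff (qnum x n) 0) x₀) (ℤₚ.*-zeroˡ (coeff (qnum x n) 0)))))

-- The polynomials of the statement as instances of the general notions

module Q = QAnalogues polyRing const-hom
module L = Ljunggren polyRing const-hom

^ₚ≋↑ : ∀ x n → x ^ₚ n ≋ x Q.↑ n
^ₚ≋↑ x zero    = ≋-refl
^ₚ≋↑ x (suc n) = *-cong {x} ≋-refl (^ₚ≋↑ x n)

qnum≋qint : ∀ x n → qnum x n ≋ Q.qint x n
qnum≋qint x zero    = ≋-refl
qnum≋qint x (suc n) = +-cong {1ₚ} ≋-refl (*-cong {x} ≋-refl (qnum≋qint x n))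

qfact≋qfactorial : ∀ x n → qfact x n ≋ Q.qfactorial x n
qfact≋qfactorial x zero    = ≋-refl
qfact≋qfactorial x (suc n) = *-cong (qnum≋qint x (suc n)) (qfact≋qfactorial x n)

module _ (x : Poly) (x₀ : coeff x 0 ≡ + 0) where

  qint₀ : ∀ n → coeff (Q.qint x (suc n)) 0 ≡ + 1
  qint₀ n = trans (sym (at (qnum≋qint x (suc n)) 0)) (coeff-qnum-0 x n x₀)

  qint-cancel : ∀ n f → Q.qint x (suc n) *ₚ f ≋ 0ₚ → f ≋ 0ₚ
  qint-cancel n = *-zero-cancelˡ (Q.qint x (suc n)) (qint₀ n)

  -- The q-factorials have constant term 1 and therefore cancel, so the factorial relation
  -- determines `f`. A base with zero constant term covers both `q` and `q^(p²)`.
  IsQBinom⇒≋qbin : ∀ n k f → IsQBinom x n k f → f ≋ Q.qbin x n k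
  IsQBinom⇒≋qbin n k f (inj₁ (k≤n , e)) = Q.qbin-unique x qint-cancel n k f k≤n
    (≋-trans (*-cong {_} {_} {f} (*-cong (≋-sym (qfact≋qfactorial x k)) (≋-sym (qfact≋qfactorial x (n ∸ k)))) ≋-refl)
      (≋-trans (coeffwise e) (qfact≋qfactorial x n)))
  IsQBinom⇒≋qbin n k f (inj₂ (n<k , e)) = ≋-trans (coeffwise e) (≋-sym (Q.qbin-< x n<k))

-- Squares of primes modulo 12

prime²-mod-12 : ∀ p → Prime p → 5 ≤ p → Σ ℕ λ m → p * p ≡ 12 * m + 1
prime²-mod-12 p p-prime 5≤p = residue (p % 12) (p / 12) (m%n<n p 12) (m≡m%n+[m/n]*n p 12)
  where
  Result : Set
  Result = Σ ℕ λ m → p * p ≡ 12 * m + 1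

  no-divisor : ∀ d → suc (suc d) < 5 → ¬ (suc (suc d) ∣ p)
  no-divisor d d<5 d∣p with prime⇒irreducible p-prime d∣p
  ... | inj₂ refl = ℕₚ.<⇒≱ d<5 5≤p

  -- The divisor is `d + 2`, equal to 2 or 3 in every use; `e (d + 2)` is the residue and
  -- `f (d + 2)` is 12.
  composite : ∀ d e f k → suc (suc d) < 5 → p ≡ e * suc (suc d) + k * (f * suc (suc d)) → Result
  composite d e f k d<5 p≡ = contradiction
    (divides (e + k * f) (trans p≡ (factor e k f (suc (suc d))))) (no-divisor d d<5)
    where
    factor : ∀ e k f d → e * d + k * (f * d) ≡ (e + k * f) * d
    factor = solve-∀

  invertible : ∀ r s k → r * r ≡ 12 * s + 1 → p ≡ r + k * 12 → Result
  invertible r s k r² refl = s + (2 * r * k + 12 * (k * k)) ,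
    trans (expand r k) (trans (cong (_+ 12 * (2 * r * k + 12 * (k * k))) r²) (collect s (2 * r * k + 12 * (k * k))))
    where
    expand : ∀ r k → (r + k * 12) * (r + k * 12) ≡ r * r + 12 * (2 * r * k + 12 * (k * k))
    expand = solve-∀
    collect : ∀ s t → (12 * s + 1) + 12 * t ≡ 12 * (s + t) + 1
    collect = solve-∀

  2<5 : 2 < 5
  2<5 = s≤s (s≤s (s≤s z≤n))
  3<5 : 3 < 5
  3<5 = s≤s (s≤s (s≤s (s≤s z≤n)))

  residue : ∀ r k → r < 12 → p ≡ r + k * 12 → Result
  residue 0  k _ = composite 0 0 6 k 2<5
  residue 1  k _ = invertible 1 0 k refl
  residue 2  k _ = composite 0 1 6 k 2<5
  residue 3  k _ = composite 1 1 4 k 3<5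
  residue 4  k _ = composite 0 2 6 k 2<5
  residue 5  k _ = invertible 5 2 k refl
  residue 6  k _ = composite 0 3 6 k 2<5
  residue 7  k _ = invertible 7 4 k refl
  residue 8  k _ = composite 0 4 6 k 2<5
  residue 9  k _ = composite 1 3 4 k 3<5
  residue 10 k _ = composite 0 5 6 k 2<5
  residue 11 k _ = invertible 11 10 k refl
  residue (suc (suc (suc (suc (suc (suc (suc (suc (suc (suc (suc (suc r)))))))))))) k
    (s≤s (s≤s (s≤s (s≤s (s≤s (s≤s (s≤s (s≤s (s≤s (s≤s (s≤s (s≤s ())))))))))))) _

theorem1 : (p a b : ℕ) → Prime p → 5 ≤ p →
    (L R : Poly) →
    IsQBinom qₚ (a * p) (b * p) L →
    IsQBinom (qₚ ^ₚ (p ^ 2)) a b R →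
    L ≡ R -ₚ const (+ ((a C (b + 1)) * ((b + 1) C 2) * ((p ^ 2 ∸ 1) / 12))) *ₚ ((qₚ ^ₚ p) -ₚ 1ₚ) ^ₚ 2
    [modₚ (qnum qₚ p) ^ₚ 3 ]
theorem1 p@(suc p′) a b p-prime 5≤p L R isL isR = proj₁ result , at (proj₂ result)
  where
  m = proj₁ (prime²-mod-12 p p-prime 5≤p)
  p²≡12m+1 = proj₂ (prime²-mod-12 p p-prime 5≤p)

  coprime : ∀ i → i < p′ → Coprime (suc i) p
  coprime i i<p′ = Coprimality.sym (Coprimality.prime⇒coprime p-prime (s≤s i<p′))

  Φ : Poly
  Φ = Q.qint qₚ p

  torsion-free : ∀ n f h → Q.# suc n *ₚ f ≋ Φ Q.↑ 3 *ₚ h → Σ Poly λ h′ → f ≋ Φ Q.↑ 3 *ₚ h′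
  torsion-free n f h e = const-cancel-multiple (+ suc n) (Φ Q.↑ 3) (λ ())
    (coeff-^-0 Φ 3 Φ₀) f h
    (≋-trans (*-cong {const (+ suc n)} {Q.# suc n} {f} (≋-sym (Q.eval-ι (+ suc n))) ≋-refl) e)
    where
    Φ₀ : coeff Φ 0 ≡ + 1
    Φ₀ = qint₀ qₚ refl p′

  p²≡p*p : p ^ 2 ≡ p * p
  p²≡p*p = cong (p *_) (ℕₚ.*-identityʳ p)

  m≡ : (p ^ 2 ∸ 1) / 12 ≡ m
  m≡ = trans (cong (λ n → (n ∸ 1) / 12) (trans p²≡p*p p²≡12m+1))
    (trans (cong (_/ 12) (trans (ℕₚ.m+n∸n≡m (12 * m) 1) (ℕₚ.*-comm 12 m))) (m*n/n≡m m 12))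

  -- As `p` is a successor, so is `p ^ 2` by reduction, and the power unfolds to `q` times a lower
  -- power.
  X₀ : coeff (qₚ ^ₚ (p ^ 2)) 0 ≡ + 0
  X₀ = trans (coeff-* qₚ (qₚ ^ₚ (p ^ 2 ∸ 1)) 0) (ℤₚ.*-zeroˡ (coeff (qₚ ^ₚ (p ^ 2 ∸ 1)) 0))

  X≋ : qₚ ^ₚ (p ^ 2) ≋ qₚ Q.↑ (p * p)
  X≋ = ≋-trans (^ₚ≋↑ qₚ (p ^ 2)) (≋-reflexive (cong (qₚ Q.↑_) p²≡p*p))

  coefficient≡ : (a C (b + 1)) * ((b + 1) C 2) * ((p ^ 2 ∸ 1) / 12) ≡ (a C suc b) * (suc b C 2) * m
  coefficient≡ = cong₂ (λ c n → (a C c) * (c C 2) * n) (ℕₚ.+-comm b 1) m≡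

  result : Σ Poly λ h → L -ₚ (R -ₚ const (+ ((a C (b + 1)) * ((b + 1) C 2) * ((p ^ 2 ∸ 1) / 12))) *ₚ ((qₚ ^ₚ p) -ₚ 1ₚ) ^ₚ 2)
           ≋ qnum qₚ p ^ₚ 3 *ₚ h
  result = L.qbin-ljunggren-Σ qₚ p′ (qint-cancel qₚ refl) coprime m p²≡12m+1 torsion-free a b
    (IsQBinom⇒≋qbin qₚ refl (a * p) (b * p) L isL)
    (≋-trans (IsQBinom⇒≋qbin (qₚ ^ₚ (p ^ 2)) X₀ a b R isR) (Q.qbin-cong X≋ a b))
    (≋-trans (≋-reflexive (cong (λ n → const (+ n)) coefficient≡)) (≋-sym (Q.eval-ι (+ ((a C suc b) * (suc b C 2) * m)))))
    (+-cong {qₚ ^ₚ p} (^ₚ≋↑ qₚ p) ≋-refl)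
    (qnum≋qint qₚ p)
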